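{- The problem $k$-INDEPENDENT DOMINATING SET restricted to unit 2-track interval graphs is W[1]-hard with parameter $k$.
   Context: A dominating set of a graph $H$ is a set $D$ of vertices such that every vertex of $H$ is in $D$ or adjacent to a vertex of $D$. An independent dominating set is a set that is both a dominating set and an independent set. $k$-INDEPENDENT DOMINATING SET: given a graph $H$ and an integer $k$, decide whether $H$ has an independent dominating set of $k$ vertices. The intersection graph of a family of sets has one vertex per member, two different members being adjacent iff they intersect; the family is a representation of the graph. A 2-track interval is the union of two intervals on two disjoint parallel lines (tracks), one interval on each track. A unit 2-track interval graph is the intersection graph of a family of 2-track intervals in which all intervals have unit length. Such a representation of $H$ is given as part of the input. A parameterized problem is W[1]-hard if every problem in W[1] has an FPT reduction to it; equivalently, if $k$-CLIQUE in general graphs (parameter $k$) has an FPT reduction to it. An FPT reduction maps an instance $(x,k)$ to an equivalent instance $(x',k')$ in time $g(k)\cdot|x|^{O(1)}$ with $k'\le h(k)$, for computable functions $g,h$. -}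

module Defs where

open import Data.Bool using (Bool; true; false; T)
open import Data.Fin using (Fin)
open import Data.Fin.Subset using (Subset; _∈_; ∣_∣)
open import Data.Integer using (ℤ; +_; -[1+_])
open import Data.List using (List; []; _∷_; length; lookup; map; tabulate)
open import Data.Nat using (ℕ; zero; suc; _+_; _*_; _∸_; _^_; _≤_)
open import Data.Nat.ListAction using (sum)
open import Data.Nat.Logarithm using (⌈log₂_⌉)
open import Data.Product using (Σ; ∃-syntax; _×_; _,_; proj₂)
open import Data.Rational.Unnormalised as ℚᵘ using (ℚᵘ; 1ℚᵘ; ↥_; ↧ₙ_)
open import Data.Sum using (_⊎_; inj₁; inj₂)
open import Data.Unit using (⊤; tt)
open import Function.Bundles using (_⇔_)
open import Relation.Binary.PropositionalEquality using (_≡_; _≢_; refl; subst; ≢-sym)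
open import Relation.Nullary using (¬_)
open import Relation.Unary using (Pred; _≬_)
open import Level using (0ℓ)

infixr 7 _⊗_
infixr 6 _⊕_
infixr 5 _⨾_

------------------------------------------------------------------------
-- Model of computation: a Turing-complete first-order language over
-- finite data, with logarithmic cost.  Numbers count by their binary
-- length, and every primitive step is charged the full size of its input
-- and output, so running time is polynomially related to that of a
-- multitape Turing machine.

data Ty : Set where
  unit nat : Ty
  _⊗_ _⊕_  : Ty → Ty → Ty
  list     : Ty → Ty

⟦_⟧ : Ty → Set
⟦ unit ⟧   = ⊤
⟦ nat ⟧    = ℕ
⟦ A ⊗ B ⟧  = ⟦ A ⟧ × ⟦ B ⟧
⟦ A ⊕ B ⟧  = ⟦ A ⟧ ⊎ ⟦ B ⟧
⟦ list A ⟧ = List ⟦ A ⟧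

-- ⌈log₂ (1 + n)⌉ is the number of binary digits of n (none for 0).
size : ∀ A → ⟦ A ⟧ → ℕ
size unit     _        = 1
size nat      n        = suc ⌈log₂ suc n ⌉
size (A ⊗ B)  (x , y)  = suc (size A x + size B y)
size (A ⊕ B)  (inj₁ x) = suc (size A x)
size (A ⊕ B)  (inj₂ y) = suc (size B y)
size (list A) xs       = suc (sum (map (λ x → suc (size A x)) xs))

data Prim : Ty → Ty → Set where
  id          : ∀ {A} → Prim A A
  fst         : ∀ {A B} → Prim (A ⊗ B) A
  snd         : ∀ {A B} → Prim (A ⊗ B) B
  inl         : ∀ {A B} → Prim A (A ⊕ B)
  inr         : ∀ {A B} → Prim B (A ⊕ B)
  dist        : ∀ {A B C} → Prim ((A ⊕ B) ⊗ C) ((A ⊗ C) ⊕ (B ⊗ C))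
  bang        : ∀ {A} → Prim A unit
  nil         : ∀ {A B} → Prim A (list B)
  cons        : ∀ {A} → Prim (A ⊗ list A) (list A)
  uncons      : ∀ {A} → Prim (list A) (unit ⊕ (A ⊗ list A))
  lit         : ∀ {A} → ℕ → Prim A nat
  unsuc       : Prim nat (unit ⊕ nat)
  add sub mul : Prim (nat ⊗ nat) nat

apply : ∀ {A B} → Prim A B → ⟦ A ⟧ → ⟦ B ⟧
apply id      x            = x
apply fst     (x , _)      = x
apply snd     (_ , y)      = y
apply inl     x            = inj₁ x
apply inr     y            = inj₂ y
apply dist    (inj₁ x , z) = inj₁ (x , z)
apply dist    (inj₂ y , z) = inj₂ (y , z)
apply bang    _            = tt
apply nil     _            = []
apply cons    (x , xs)     = x ∷ xs
apply uncons  []           = inj₁ tt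
apply uncons  (x ∷ xs)     = inj₂ (x , xs)
apply (lit n) _            = n
apply unsuc   zero         = inj₁ tt
apply unsuc   (suc n)      = inj₂ n
apply add     (m , n)      = m + n
apply sub     (m , n)      = m ∸ n
apply mul     (m , n)      = m * n

-- `loop p` runs p repeatedly while it returns on the left; it need not
-- terminate.
data Prog : Ty → Ty → Set where
  prim  : ∀ {A B} → Prim A B → Prog A B
  _⨾_   : ∀ {A B C} → Prog A B → Prog B C → Prog A C
  ⟨_,_⟩ : ∀ {A B C} → Prog A B → Prog A C → Prog A (B ⊗ C)
  case  : ∀ {A B C} → Prog A C → Prog B C → Prog (A ⊕ B) C
  loop  : ∀ {A B} → Prog A (A ⊕ B) → Prog A B

-- Run p x y t: on input x, program p halts with output y after time t.
data Run : ∀ {A B} → Prog A B → ⟦ A ⟧ → ⟦ B ⟧ → ℕ → Set where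
  run-prim : ∀ {A B} (p : Prim A B) (x : ⟦ A ⟧) →
             Run (prim p) x (apply p x) (size A x + size B (apply p x))
  run-⨾    : ∀ {A B C} {p : Prog A B} {q : Prog B C} {x y z s t} →
             Run p x y s → Run q y z t → Run (p ⨾ q) x z (suc (s + t))
  run-⟨,⟩  : ∀ {A B C} {p : Prog A B} {q : Prog A C} {x y z s t} →
             Run p x y s → Run q x z t → Run ⟨ p , q ⟩ x (y , z) (suc (s + t))
  run-inj₁ : ∀ {A B C} {p : Prog A C} {q : Prog B C} {x z t} →
             Run p x z t → Run (case p q) (inj₁ x) z (suc t)
  run-inj₂ : ∀ {A B C} {p : Prog A C} {q : Prog B C} {y z t} →
             Run q y z t → Run (case p q) (inj₂ y) z (suc t)
  run-next : ∀ {A B} {p : Prog A (A ⊕ B)} {x x′ y s t} →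
             Run p x (inj₁ x′) s → Run (loop p) x′ y t →
             Run (loop p) x y (suc (s + t))
  run-exit : ∀ {A B} {p : Prog A (A ⊕ B)} {x y t} →
             Run p x (inj₂ y) t → Run (loop p) x y (suc t)

Computable : (ℕ → ℕ) → Set
Computable f = Σ (Prog nat nat) λ p → ∀ n → ∃[ t ] Run p n (f n) t

------------------------------------------------------------------------
-- Parameterized problems and reductions

record ParamProblem : Set₁ where
  field
    Instance : Set
    code     : Ty
    encode   : Instance → ⟦ code ⟧
    param    : Instance → ℕ
    Yes      : Instance → Set

  ∥_∥ : Instance → ℕ
  ∥ x ∥ = size code (encode x)

record FPTReduction (P Q : ParamProblem) : Set where
  private
    module P = ParamProblem P
    module Q = ParamProblem Q
  field
    f            : P.Instance → Q.Instance
    equivalent   : ∀ x → P.Yes x ⇔ Q.Yes (f x)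
    program      : Prog P.code Q.code
    g h          : ℕ → ℕ
    g-computable : Computable g
    h-computable : Computable h
    exponent     : ℕ
    runs         : ∀ x → ∃[ t ] Run program (P.encode x) (Q.encode (f x)) t
                               × t ≤ g (P.param x) * P.∥ x ∥ ^ exponent
    param-bound  : ∀ x → Q.param (f x) ≤ h (P.param x)

------------------------------------------------------------------------
-- Graphs

record Graph (n : ℕ) : Set₁ where
  field
    Adj        : Fin n → Fin n → Set
    Adj-sym    : ∀ {i j} → Adj i j → Adj j i
    Adj-irrefl : ∀ {i} → ¬ Adj i i

module _ {n : ℕ} (G : Graph n) where
  open Graph G

  IsClique : Subset n → Set
  IsClique C = ∀ {i j} → i ∈ C → j ∈ C → i ≢ j → Adj i j

  IsIndependent : Subset n → Set
  IsIndependent D = ∀ {i j} → i ∈ D → j ∈ D → ¬ Adj i j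

  IsDominating : Subset n → Set
  IsDominating D = ∀ v → v ∈ D ⊎ ∃[ u ] u ∈ D × Adj v u

  HasClique : ℕ → Set
  HasClique k = ∃[ C ] IsClique C × ∣ C ∣ ≡ k

  HasIndependentDominatingSet : ℕ → Set
  HasIndependentDominatingSet k =
    ∃[ D ] IsDominating D × IsIndependent D × ∣ D ∣ ≡ k

record AdjacencyMatrix (n : ℕ) : Set where
  field
    entry        : Fin n → Fin n → Bool
    entry-sym    : ∀ i j → entry i j ≡ entry j i
    entry-irrefl : ∀ i → entry i i ≡ false

graph : ∀ {n} → AdjacencyMatrix n → Graph n
graph M = record
  { Adj        = λ i j → T (entry i j)
  ; Adj-sym    = λ {i} {j} → subst T (entry-sym i j)
  ; Adj-irrefl = λ {i} → subst T (entry-irrefl i)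
  }
  where open AdjacencyMatrix M

encodeBool : Bool → ⟦ unit ⊕ unit ⟧
encodeBool false = inj₁ tt
encodeBool true  = inj₂ tt

encodeMatrix : ∀ {n} → AdjacencyMatrix n → ⟦ list (list (unit ⊕ unit)) ⟧
encodeMatrix M = tabulate λ i → tabulate λ j → encodeBool (entry i j)
  where open AdjacencyMatrix M

k-Clique : ParamProblem
k-Clique = record
  { Instance = (∃[ n ] AdjacencyMatrix n) × ℕ
  ; code     = list (list (unit ⊕ unit)) ⊗ nat
  ; encode   = λ { ((_ , M) , k) → encodeMatrix M , k }
  ; param    = proj₂
  ; Yes      = λ { ((_ , M) , k) → HasClique (graph M) k }
  }

------------------------------------------------------------------------
-- Intersection graphs

intersectionGraph : ∀ {X : Set} {n} → (Fin n → Pred X 0ℓ) → Graph n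
intersectionGraph F = record
  { Adj        = λ i j → i ≢ j × F i ≬ F j
  ; Adj-sym    = λ { (i≢j , x , x∈Fi , x∈Fj) → ≢-sym i≢j , x , x∈Fj , x∈Fi }
  ; Adj-irrefl = λ { (i≢i , _) → i≢i refl }
  }

data Track : Set where
  track₁ track₂ : Track

-- Instances are finite data, so endpoints are rational.  Closed intervals
-- with rational endpoints share a real point iff they share a rational
-- one, so rational points on each track suffice.
Point : Set
Point = Track × ℚᵘ

unitInterval : ℚᵘ → Pred ℚᵘ 0ℓ
unitInterval a x = a ℚᵘ.≤ x × x ℚᵘ.≤ a ℚᵘ.+ 1ℚᵘ

-- A unit interval on each track, given by its left endpoint.
record Unit2TrackInterval : Set where
  constructor _∣∣_
  field
    left₁ left₂ : ℚᵘ

  points : Pred Point 0ℓ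
  points (track₁ , x) = unitInterval left₁ x
  points (track₂ , x) = unitInterval left₂ x

unit2TrackGraph : (F : List Unit2TrackInterval) → Graph (length F)
unit2TrackGraph F =
  intersectionGraph λ i → Unit2TrackInterval.points (lookup F i)

encodeℤ : ℤ → ⟦ nat ⊕ nat ⟧
encodeℤ (+ n)    = inj₁ n
encodeℤ -[1+ n ] = inj₂ n

encodeℚ : ℚᵘ → ⟦ (nat ⊕ nat) ⊗ nat ⟧
encodeℚ q = encodeℤ (↥ q) , ↧ₙ q

encodeUnit2TrackInterval :
  Unit2TrackInterval →
  ⟦ ((nat ⊕ nat) ⊗ nat) ⊗ ((nat ⊕ nat) ⊗ nat) ⟧
encodeUnit2TrackInterval (a ∣∣ b) = encodeℚ a , encodeℚ b

-- The input graph is presented by its representation, which determines it.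
k-IndependentDominatingSet-Unit2Track : ParamProblem
k-IndependentDominatingSet-Unit2Track = record
  { Instance = List Unit2TrackInterval × ℕ
  ; code     = list (((nat ⊕ nat) ⊗ nat) ⊗ ((nat ⊕ nat) ⊗ nat)) ⊗ nat
  ; encode   = λ { (F , k) → map encodeUnit2TrackInterval F , k }
  ; param    = proj₂
  ; Yes      = λ { (F , k) → HasIndependentDominatingSet (unit2TrackGraph F) k }
  }

------------------------------------------------------------------------

-- k-Clique is W[1]-complete, so one reduction from it gives a reduction
-- from every problem in W[1].
W[1]-Hard : ParamProblem → Set
W[1]-Hard Q = FPTReduction k-Clique Q

{-# OPTIONS --safe #-}
module Submission where

-- The K × K cells (i , j) each get an interval region on track 1 and one on track 2.  In cell
-- (i , j) one chooses an adjacent pair (u , v), whose track 1 offset shows u and whose track 2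
-- offset shows v; the diagonal cells also offer the pairs (u , u).  Two guards per cell, close to
-- all its choices but to no further common position, force a dominating set of K² positions to
-- consist of one choice per cell.  A tie reaches from the track 1 region of cell (i , j) to the
-- track 2 region of cell (l , i), and is dominated iff the former has u ≤ q or the latter v > q
-- (respectively u > q or v ≤ q), so all ties together force this u and this v to be equal.  Hence
-- the i-th row and the i-th column agree on one vertex, and these vertices form a clique.

open import Defs
open import Data.Bool using (true; T)
open import Data.Fin as Fin using (Fin; zero; suc; toℕ; opposite; combine; remQuot)
open import Data.Fin.Patterns using (0F; 1F; 2F)
open import Data.Fin.Properties as Finₚ using (any?; injective⇒≤; toℕ-injective; toℕ-fromℕ; toℕ-inject₁)
open import Data.Fin.Subset using (Subset; _∈_; ∣_∣; inside; outside)
open import Data.Fin.Subset.Properties using (p⊂q⇒∣p∣<∣q∣; ∣p∣≤n)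
import Data.Integer as ℤ
import Data.Integer.Properties as ℤₚ
open import Data.List using (List; []; _∷_; length; lookup; map; tabulate; _ʳ++_)
open import Data.List.Membership.Propositional using () renaming (_∈_ to _∈ˡ_)
open import Data.List.Membership.Propositional.Properties using (∈-lookup)
open import Data.List.Properties using (length-tabulate; map-ʳ++)
open import Data.List.Relation.Unary.Any using (here; there; index)
open import Data.List.Relation.Unary.Any.Properties using (reverseAcc⁺; reverseAcc⁻; lookup-index)
open import Data.Nat
open import Data.Nat.Induction using (<-rec)
open import Data.Nat.ListAction using (sum)
open import Data.Nat.Logarithm
open import Data.Nat.Properties
open import Data.Product using (∃-syntax; _×_; _,_; proj₁; proj₂; uncurry)
open import Data.Rational.Unnormalised as ℚᵘ using (ℚᵘ; mkℚᵘ; 1ℚᵘ; *≡*; *≤*; _≃_)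
import Data.Rational.Unnormalised.Properties as ℚᵘₚ
open import Data.Sum using (_⊎_; inj₁; inj₂; [_,_]′)
open import Data.Vec as Vec using (_∷_; here; there)
open import Data.Vec.Properties using ([]=⇒lookup; lookup⇒[]=; lookup∘tabulate)
open import Function using (_∘_; Injective)
open import Function.Bundles using (_⇔_; mk⇔; Equivalence)
open import Function.Construct.Composition using (_⇔-∘_)
open import Relation.Binary using (tri<; tri≈; tri>)
open import Relation.Binary.PropositionalEquality
  using (_≡_; _≢_; refl; sym; trans; cong; cong₂; subst; subst₂; module ≡-Reasoning)
open import Relation.Nullary using (¬_; yes; no; does; contradiction)
open import Relation.Nullary.Decidable using (dec-true)
open import Relation.Unary using (_≬_)

-- Polynomial-time programs

-- Unit length leaves an interval nothing but its shift, so the shift has to perform the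
-- comparisons. Endpoints are multiples of 1/N with N = n + 1, so that intervals have integer length
-- N, and a choice showing label a sits at offset N + a. An interval at offset q just reaches it
-- from the left when a ≤ q, and one at offset 2N + 1 + q just reaches it from the right when a > q.
-- A tie has one end on each track, so its domination is a disjunction of two opposite comparisons
-- with the same q, one at each end. All offsets stay within 3N, which is why regions 5N apart are
-- independent of each other. Choices of different cells share no region on either track, so a set
-- with one choice per cell is independent by construction. The running time is an obstacle of its
-- own: the machine language has unrestricted loops, and an accumulator that doubled at each pass
-- would grow exponentially. The programs are therefore built from combinators that carry a
-- polynomial bound along, with loops only in the form of folds whose accumulator grows additively.

private
  variable
    A B C Γ : Ty

n≤2^⌈log₂n⌉ : ∀ n → n ≤ 2 ^ ⌈log₂ n ⌉
n≤2^⌈log₂n⌉ = <-rec _ step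
  where
  open ≤-Reasoning
  step : ∀ n → (∀ {m} → m < n → m ≤ 2 ^ ⌈log₂ m ⌉) → n ≤ 2 ^ ⌈log₂ n ⌉
  step zero             rec = z≤n
  step (suc zero)       rec = m^n>0 2 ⌈log₂ 1 ⌉
  step n@(suc (suc n′)) rec = begin
    n                            ≡⟨ ⌊n/2⌋+⌈n/2⌉≡n n ⟨
    ⌊ n /2⌋ + ⌈ n /2⌉            ≤⟨ +-mono-≤ (⌊n/2⌋≤⌈n/2⌉ n) (m≤m+n ⌈ n /2⌉ 0) ⟩
    2 * ⌈ n /2⌉                  ≤⟨ *-monoʳ-≤ 2 (rec (⌈n/2⌉<n n′)) ⟩
    2 * 2 ^ ⌈log₂ ⌈ n /2⌉ ⌉      ≡⟨ cong (λ e → 2 * 2 ^ e) (⌈log₂⌈n/2⌉⌉≡⌈log₂n⌉∸1 n) ⟩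
    2 ^ suc (⌈log₂ n ⌉ ∸ 1)      ≡⟨ cong (2 ^_) (m+[n∸m]≡n 1≤log) ⟩
    2 ^ ⌈log₂ n ⌉                ∎
    where
    1≤log : 1 ≤ ⌈log₂ n ⌉
    1≤log = ≤-trans (≤-reflexive (sym (⌈log₂2^n⌉≡n 1))) (⌈log₂⌉-mono-≤ {2} {n} (s≤s (s≤s z≤n)))

⌈log₂m*n⌉≤⌈log₂m⌉+⌈log₂n⌉ : ∀ m n → ⌈log₂ (m * n) ⌉ ≤ ⌈log₂ m ⌉ + ⌈log₂ n ⌉
⌈log₂m*n⌉≤⌈log₂m⌉+⌈log₂n⌉ m n = begin
  ⌈log₂ (m * n) ⌉                          ≤⟨ ⌈log₂⌉-mono-≤ (*-mono-≤ (n≤2^⌈log₂n⌉ m) (n≤2^⌈log₂n⌉ n)) ⟩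
  ⌈log₂ (2 ^ ⌈log₂ m ⌉ * 2 ^ ⌈log₂ n ⌉) ⌉  ≡⟨ cong ⌈log₂_⌉ (^-distribˡ-+-* 2 ⌈log₂ m ⌉ ⌈log₂ n ⌉) ⟨
  ⌈log₂ (2 ^ (⌈log₂ m ⌉ + ⌈log₂ n ⌉)) ⌉    ≡⟨ ⌈log₂2^n⌉≡n _ ⟩
  ⌈log₂ m ⌉ + ⌈log₂ n ⌉                    ∎
  where open ≤-Reasoning

m<2^m : ∀ m → m < 2 ^ m
m<2^m zero    = s≤s z≤n
m<2^m (suc m) = begin
  suc (suc m)    ≤⟨ s≤s (m<2^m m) ⟩
  suc (2 ^ m)    ≤⟨ +-mono-≤ (m^n>0 2 m) (m≤m+n (2 ^ m) 0) ⟩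
  2 ^ suc m      ∎
  where open ≤-Reasoning

-- A record rather than a synonym, so that the exponents, which are never written
-- out, are found by unification without unfolding any power.
infix 4 _≤_^′_
record _≤_^′_ (m b d : ℕ) : Set where
  constructor poly
  field bound : m ≤ b ^ d

open _≤_^′_

-- With base at least 2 a sum of two powers is absorbed by one further factor, and a constant `m`
-- lies below `b ^ m`. The base used below is one more than an input size, and sizes are positive.
module Powers {b : ℕ} (2≤b : 2 ≤ b) where
  private
    instance
      b≢0 : NonZero b
      b≢0 = >-nonZero (<⇒≤ 2≤b)

  base : ∀ {m} → m ≤ b → m ≤ b ^′ 1
  base m≤b = poly (≤-trans m≤b (≤-reflexive (sym (*-identityʳ b))))

  constant : ∀ m → m ≤ b ^′ m
  constant m = poly (≤-trans (<⇒≤ (m<2^m m)) (^-monoˡ-≤ m 2≤b))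

  infixl 6 _+′_
  _+′_ : ∀ {m n i j} → m ≤ b ^′ i → n ≤ b ^′ j → m + n ≤ b ^′ suc (i + j)
  _+′_ {m} {n} {i} {j} m≤ n≤ = poly (begin
    m + n                          ≤⟨ +-mono-≤ (bound m≤) (bound n≤) ⟩
    b ^ i + b ^ j                  ≤⟨ +-mono-≤ (^-monoʳ-≤ b (m≤m+n i j)) (^-monoʳ-≤ b (m≤n+m j i)) ⟩
    b ^ (i + j) + b ^ (i + j)      ≤⟨ +-monoʳ-≤ (b ^ (i + j)) (m≤m+n _ 0) ⟩
    2 * b ^ (i + j)                ≤⟨ *-monoˡ-≤ (b ^ (i + j)) 2≤b ⟩
    b ^ suc (i + j)                ∎)
    where open ≤-Reasoning

  suc′ : ∀ {m i} → m ≤ b ^′ i → suc m ≤ b ^′ suc i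
  suc′ = poly ≤-refl +′_

  infixl 7 _*′_
  _*′_ : ∀ {m n i j} → m ≤ b ^′ i → n ≤ b ^′ j → m * n ≤ b ^′ (i + j)
  _*′_ {i = i} {j} m≤ n≤ = poly (≤-trans (*-mono-≤ (bound m≤) (bound n≤)) (≤-reflexive (sym (^-distribˡ-+-* b i j))))

  power : ∀ {m i} → m ≤ b ^′ i → ∀ j → m ^ j ≤ b ^′ (i * j)
  power {i = i} m≤ j = poly (≤-trans (^-monoˡ-≤ j (bound m≤)) (≤-reflexive (^-*-assoc b i j)))

  weaken : ∀ {m n i} → m ≤ n → n ≤ b ^′ i → m ≤ b ^′ i
  weaken m≤n n≤ = poly (≤-trans m≤n (bound n≤))

-- Sizes of values and of primitive results

1≤size : ∀ A x → 1 ≤ size A x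
1≤size unit     _        = s≤s z≤n
1≤size nat      _        = s≤s z≤n
1≤size (A ⊗ B)  _        = s≤s z≤n
1≤size (A ⊕ B)  (inj₁ _) = s≤s z≤n
1≤size (A ⊕ B)  (inj₂ _) = s≤s z≤n
1≤size (list A) _        = s≤s z≤n

length<size : ∀ A xs → length xs < size (list A) xs
length<size A []       = s≤s z≤n
length<size A (x ∷ xs) = s≤s (s≤s (≤-trans (s≤s⁻¹ (length<size A xs)) (m≤n+m _ (size A x))))

size-suc : ∀ n → size nat (suc n) ≤ suc (size nat n)
size-suc n = s≤s (begin
  ⌈log₂ suc (suc n) ⌉   ≤⟨ ⌈log₂⌉-mono-≤ (+-mono-≤ (s≤s (z≤n {n})) (m≤m+n (suc n) 0)) ⟩
  ⌈log₂ (2 * suc n) ⌉   ≡⟨ ⌈log₂2*n⌉≡1+⌈log₂n⌉ (suc n) ⟩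
  suc ⌈log₂ suc n ⌉     ∎)
  where open ≤-Reasoning

-- Both the sum and the product of m and n lie below (m + 1)(n + 1), so this one estimate serves
-- `add` and `mul`.
size-≤-product : ∀ m n r → r < suc m * suc n → size nat r ≤ suc (suc (size (nat ⊗ nat) (m , n)))
size-≤-product m n r r< = begin
  suc ⌈log₂ suc r ⌉                            ≤⟨ s≤s (⌈log₂⌉-mono-≤ r<) ⟩
  suc ⌈log₂ (suc m * suc n) ⌉                  ≤⟨ s≤s (⌈log₂m*n⌉≤⌈log₂m⌉+⌈log₂n⌉ (suc m) (suc n)) ⟩
  suc (⌈log₂ suc m ⌉ + ⌈log₂ suc n ⌉)          ≤⟨ s≤s (+-mono-≤ (n≤1+n _) (n≤1+n _)) ⟩
  suc (size nat m + size nat n)                ≤⟨ ≤-trans (n≤1+n _) (n≤1+n _) ⟩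
  suc (suc (suc (size nat m + size nat n)))    ∎
  where open ≤-Reasoning

size-ʳ++ : ∀ A xs ys → size (list A) (xs ʳ++ ys) ≤ size (list A) ys + size (list A) xs
size-ʳ++ A []       ys = m≤m+n _ 1
size-ʳ++ A (x ∷ xs) ys = begin
  size (list A) (xs ʳ++ (x ∷ ys))                        ≤⟨ size-ʳ++ A xs (x ∷ ys) ⟩
  suc (suc (size A x) + s ys) + suc (s xs)               ≡⟨ regroup (size A x) (s ys) (s xs) ⟩
  suc (s ys) + suc (suc (size A x) + s xs)               ∎
  where
  open ≤-Reasoning
  s : List ⟦ A ⟧ → ℕ
  s zs = sum (map (λ z → suc (size A z)) zs)
  regroup : ∀ (a y z : ℕ) → suc (suc a + y) + suc z ≡ suc y + suc (suc a + z)
  regroup a y z = cong suc (begin-equality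
    suc a + y + suc z     ≡⟨ cong (_+ suc z) (+-comm (suc a) y) ⟩
    y + suc a + suc z     ≡⟨ +-assoc y (suc a) (suc z) ⟩
    y + (suc a + suc z)   ≡⟨ cong (y +_) (+-suc (suc a) z) ⟩
    y + suc (suc a + z)   ∎)

-- Only `lit` can produce an output that exceeds its input by more than two size units; its excess
-- depends on the program alone.
literal : Prim A B → ℕ
literal {A} (lit n) = size nat n
literal     _       = 0

size-apply : (p : Prim A B) (x : ⟦ A ⟧) → size B (apply p x) ≤ literal p + suc (suc (size A x))
size-apply id x                = ≤-trans (n≤1+n _) (n≤1+n _)
size-apply fst (x , y)         = ≤-trans (m≤m+n _ _) (m≤n+m _ 3)
size-apply snd (x , y)         = ≤-trans (m≤n+m _ _) (m≤n+m _ 3)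
size-apply inl x               = n≤1+n _
size-apply inr x               = n≤1+n _
size-apply dist (inj₁ x , z)   = ≤-trans (n≤1+n _) (n≤1+n _)
size-apply dist (inj₂ y , z)   = ≤-trans (n≤1+n _) (n≤1+n _)
size-apply bang x              = s≤s z≤n
size-apply nil x               = s≤s z≤n
size-apply cons (x , xs)       = ≤-trans (s≤s (≤-reflexive (sym (+-suc _ _)))) (m≤n+m _ 2)
size-apply uncons []           = s≤s (s≤s z≤n)
size-apply uncons (x ∷ xs)     = s≤s (s≤s (≤-trans (≤-reflexive (+-suc _ _)) (n≤1+n _)))
size-apply {A} (lit n) x       = m≤m+n _ (suc (suc (size A x)))
size-apply unsuc zero          = s≤s (s≤s z≤n)
size-apply unsuc (suc n)       = s≤s (≤-trans (s≤s (⌈log₂⌉-mono-≤ (n≤1+n (suc n)))) (n≤1+n _))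
size-apply add (m , n)         = size-≤-product m n (m + n) (s≤s (begin
  m + n        ≡⟨ +-comm m n ⟩
  n + m        ≡⟨ cong (n +_) (*-identityʳ m) ⟨
  n + m * 1    ≤⟨ +-monoʳ-≤ n (*-monoʳ-≤ m (s≤s z≤n)) ⟩
  n + m * suc n ∎))
  where open ≤-Reasoning
size-apply sub (m , n)         =
  ≤-trans (s≤s (⌈log₂⌉-mono-≤ (s≤s (m∸n≤m m n)))) (≤-trans (m≤m+n _ _) (m≤n+m _ 3))
size-apply mul (m , n)         =
  size-≤-product m n (m * n) (s≤s (≤-trans (*-monoʳ-≤ m (n≤1+n n)) (m≤n+m _ n)))

-- Every primitive is charged for its output. A time bound thus also bounds the intermediate value
-- handed to the next program, which is what makes composition polynomial.
Run⇒output≤time : ∀ {p : Prog A B} {x y t} → Run p x y t → size B y ≤ t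
Run⇒output≤time (run-prim p x)  = m≤n+m _ _
Run⇒output≤time (run-⨾ {s = s} r r′) = ≤-trans (Run⇒output≤time r′) (≤-trans (m≤n+m _ s) (n≤1+n _))
Run⇒output≤time (run-⟨,⟩ r r′)  = s≤s (+-mono-≤ (Run⇒output≤time r) (Run⇒output≤time r′))
Run⇒output≤time (run-inj₁ r)    = ≤-trans (Run⇒output≤time r) (n≤1+n _)
Run⇒output≤time (run-inj₂ r)    = ≤-trans (Run⇒output≤time r) (n≤1+n _)
Run⇒output≤time (run-next {s = s} r r′) = ≤-trans (Run⇒output≤time r′) (≤-trans (m≤n+m _ s) (n≤1+n _))
Run⇒output≤time (run-exit {y = y} r) = ≤-trans (≤-trans (n≤1+n _) (Run⇒output≤time r)) (n≤1+n _)

-- Programs carrying a polynomial time bound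

PolyTime : (⟦ A ⟧ → ⟦ B ⟧) → Prog A B → Set
PolyTime {A} f p = ∃[ d ] ∀ x → ∃[ t ] Run p x (f x) t × t ≤ suc (size A x) ^′ d

infix 4 _⟶_

record _⟶_ (A B : Ty) : Set where
  field
    fun      : ⟦ A ⟧ → ⟦ B ⟧
    prog     : Prog A B
    polyTime : PolyTime fun prog

  deg : ℕ
  deg = proj₁ polyTime

  runs : ∀ x → ∃[ t ] Run prog x (fun x) t × t ≤ suc (size A x) ^′ deg
  runs = proj₂ polyTime

  size-fun : ∀ x → size B (fun x) ≤ suc (size A x) ^′ deg
  size-fun x with _ , r , poly t≤ ← runs x = poly (≤-trans (Run⇒output≤time r) t≤)

open _⟶_

-- Opaque, since the exponents are closed and conversion checking would
-- otherwise unfold powers to them.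
opaque
  prim-polyTime : (p : Prim A B) → PolyTime (apply p) (prim p)
  prim-polyTime {A} p = _ , λ x →
    let open Powers (s≤s (1≤size A x)) in
    _ , run-prim p x ,
    base (n≤1+n _) +′ weaken (size-apply p x) (constant (literal p) +′ suc′ (suc′ (base (n≤1+n _))))

  ⨾-polyTime : (f : A ⟶ B) (g : B ⟶ C) → PolyTime (fun g ∘ fun f) (prog f ⨾ prog g)
  ⨾-polyTime {A} f g = _ , λ x →
    let open Powers (s≤s (1≤size A x))
        s , r , s≤ = runs f x
        t , q , t≤ = runs g (fun f x)
    in suc (s + t) , run-⨾ r q ,
       suc′ (s≤ +′ weaken (bound t≤) (power (suc′ (size-fun f x)) (deg g)))

  ⟨,⟩-polyTime : (f : A ⟶ B) (g : A ⟶ C) → PolyTime (λ x → fun f x , fun g x) ⟨ prog f , prog g ⟩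
  ⟨,⟩-polyTime {A} f g = _ , λ x →
    let open Powers (s≤s (1≤size A x))
        s , r , s≤ = runs f x
        t , q , t≤ = runs g x
    in suc (s + t) , run-⟨,⟩ r q , suc′ (s≤ +′ t≤)

  case-polyTime : (f : A ⟶ C) (g : B ⟶ C) → PolyTime [ fun f , fun g ]′ (case (prog f) (prog g))
  case-polyTime {A} {C} {B} f g = suc (deg f + deg g) , λ where
    (inj₁ x) →
      let open Powers {suc (suc (size A x))} (s≤s (s≤s z≤n))
          t , r , t≤ = runs f x
      in suc t , run-inj₁ r , suc′ (weaken (bound t≤) (poly
           (≤-trans (^-monoˡ-≤ (deg f) (n≤1+n _)) (^-monoʳ-≤ _ (m≤m+n (deg f) (deg g))))))
    (inj₂ x) →
      let open Powers {suc (suc (size B x))} (s≤s (s≤s z≤n))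
          t , r , t≤ = runs g x
      in suc t , run-inj₂ r , suc′ (weaken (bound t≤) (poly
           (≤-trans (^-monoˡ-≤ (deg g) (n≤1+n _)) (^-monoʳ-≤ _ (m≤n+m (deg g) (deg f))))))

ι : Prim A B → A ⟶ B
ι p = record { fun = apply p ; prog = prim p ; polyTime = prim-polyTime p }

infixr 5 _⋙_
_⋙_ : A ⟶ B → B ⟶ C → A ⟶ C
f ⋙ g = record { fun = fun g ∘ fun f ; prog = prog f ⨾ prog g ; polyTime = ⨾-polyTime f g }

infixr 6 _▵_
_▵_ : A ⟶ B → A ⟶ C → A ⟶ B ⊗ C
f ▵ g = record { fun = λ x → fun f x , fun g x ; prog = ⟨ prog f , prog g ⟩ ; polyTime = ⟨,⟩-polyTime f g }

infixr 6 _▿_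
_▿_ : A ⟶ C → B ⟶ C → A ⊕ B ⟶ C
f ▿ g = record { fun = [ fun f , fun g ]′ ; prog = case (prog f) (prog g) ; polyTime = case-polyTime f g }

p₁ : A ⊗ B ⟶ A
p₁ = ι fst

p₂ : A ⊗ B ⟶ B
p₂ = ι snd

-- Loops over lists

foldTails : ∀ {A C : Set} → (A → List A → C → C) → List A → C → C
foldTails f []       c = c
foldTails f (x ∷ xs) c = foldTails f xs (f x xs c)

reassociate : ∀ (x y z : ℕ) → x + suc (y + z) ≡ suc ((x + y) + z)
reassociate x y z = trans (+-suc x (y + z)) (cong suc (sym (+-assoc x y z)))

-- The hypothesis `grows` keeps iteration polynomial: the increment of the accumulator is bounded in
-- terms of the context, the item and the remaining list, but not of the accumulator itself.
module Fold
  {Γ A C : Ty}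
  (step : (Γ ⊗ (A ⊗ list A)) ⊗ C ⟶ C) (growth : ℕ)
  (grows : ∀ γ x xs c → size C (fun step ((γ , x , xs) , c)) ≤
                        size C c + suc (size (Γ ⊗ (A ⊗ list A)) (γ , x , xs)) ^ growth)
  where

  body : Γ ⊗ (list A ⊗ C) ⟶ (Γ ⊗ (list A ⊗ C)) ⊕ C
  body = ((p₂ ⋙ p₁ ⋙ ι uncons) ▵ (p₁ ▵ (p₂ ⋙ p₂))) ⋙ ι dist ⋙
         ((p₂ ⋙ p₂ ⋙ ι inr) ▿
          (((p₂ ⋙ p₁) ▵ (p₁ ⋙ p₂) ▵ ((((p₂ ⋙ p₁) ▵ p₁) ▵ (p₂ ⋙ p₂)) ⋙ step)) ⋙ ι inl))

  result : ⟦ Γ ⟧ → List ⟦ A ⟧ → ⟦ C ⟧ → ⟦ C ⟧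
  result γ = foldTails (λ x xs c → fun step ((γ , x , xs) , c))

  iterationBound : ℕ → ℕ → ℕ
  iterationBound s m = suc (suc (suc (s + m))) ^ deg body

  iteration-time : ∀ γ s m xs c →
    size Γ γ + size (list A) xs ≤ s →
    size C c + length xs * suc (suc s) ^ growth ≤ m →
    suc (size (Γ ⊗ (list A ⊗ C)) (γ , xs , c)) ^ deg body ≤ iterationBound s m
  iteration-time γ s m xs c s≥ m≥ = ^-monoˡ-≤ (deg body) (s≤s (s≤s (begin
    size Γ γ + suc (size (list A) xs + size C c)      ≡⟨ reassociate (size Γ γ) (size (list A) xs) (size C c) ⟩
    suc ((size Γ γ + size (list A) xs) + size C c)    ≤⟨ s≤s (+-mono-≤ s≥ (≤-trans (m≤m+n _ _) m≥)) ⟩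
    suc (s + m)                                       ∎)))
    where open ≤-Reasoning

  -- The second hypothesis is a potential argument: `m` covers the current accumulator together with
  -- all growth still to come. Each pass moves one summand from the latter to the former, so `s` and
  -- `m`, and with them the bound per pass, stay fixed throughout the loop.
  loop-runs : ∀ γ s m xs c →
    size Γ γ + size (list A) xs ≤ s →
    size C c + length xs * suc (suc s) ^ growth ≤ m →
    ∃[ t ] Run (loop (prog body)) (γ , xs , c) (result γ xs c) t ×
           t ≤ suc (length xs) * suc (iterationBound s m)
  loop-runs γ s m [] c s≥ m≥ =
    let t , r , t≤ = runs body (γ , [] , c) in
    suc t , run-exit r ,
    ≤-trans (s≤s (≤-trans (bound t≤) (iteration-time γ s m [] c s≥ m≥))) (m≤m+n _ 0)
  loop-runs γ s m (x ∷ xs) c s≥ m≥ =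
    let t , r , t≤ = runs body (γ , x ∷ xs , c)
        t′ , r′ , t′≤ = loop-runs γ s m xs (fun step ((γ , x , xs) , c)) s≥′ m≥′
    in suc (t + t′) , run-next r r′ ,
       +-mono-≤ (s≤s (≤-trans (bound t≤) (iteration-time γ s m (x ∷ xs) c s≥ m≥))) t′≤
    where
    open ≤-Reasoning
    s≥′ : size Γ γ + size (list A) xs ≤ s
    s≥′ = ≤-trans (+-monoʳ-≤ (size Γ γ) (s≤s (m≤n+m _ (suc (size A x))))) s≥
    -- The two pairings cost more than the cons cell they replace; this is the origin of
    -- `suc (suc s)` in the potential.
    size≤ : suc (size (Γ ⊗ (A ⊗ list A)) (γ , x , xs)) ≤ suc (suc s)
    size≤ = s≤s (≤-trans (≤-reflexive (cong (λ z → suc (size Γ γ + suc z)) (+-suc (size A x) _))) (s≤s s≥))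
    m≥′ : size C (fun step ((γ , x , xs) , c)) + length xs * suc (suc s) ^ growth ≤ m
    m≥′ = begin
      size C (fun step ((γ , x , xs) , c)) + length xs * suc (suc s) ^ growth
        ≤⟨ +-monoˡ-≤ _ (≤-trans (grows γ x xs c) (+-monoʳ-≤ (size C c) (^-monoˡ-≤ growth size≤))) ⟩
      size C c + suc (suc s) ^ growth + length xs * suc (suc s) ^ growth
        ≡⟨ +-assoc (size C c) _ _ ⟩
      size C c + suc (length xs) * suc (suc s) ^ growth
        ≤⟨ m≥ ⟩
      m ∎

  fold-fun : ⟦ Γ ⊗ (list A ⊗ C) ⟧ → ⟦ C ⟧
  fold-fun (γ , xs , c) = result γ xs c

  opaque
    fold-polyTime : PolyTime fold-fun (loop (prog body))
    fold-polyTime = _ , λ (γ , xs , c) →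
      let open Powers {suc (size (Γ ⊗ (list A ⊗ C)) (γ , xs , c))} (s≤s (s≤s z≤n))
          s = size Γ γ + size (list A) xs
          m = size C c + length xs * suc (suc s) ^ growth
          size≡ = cong (λ a → suc (suc a)) (reassociate (size Γ γ) (size (list A) xs) (size C c))
          2+s≤ = ≤-trans (s≤s (s≤s (≤-trans (m≤m+n s (size C c)) (n≤1+n _)))) (≤-reflexive (sym size≡))
          s≤ = ≤-trans (≤-trans (n≤1+n s) (n≤1+n _)) 2+s≤
          c≤ = ≤-trans (m≤n+m (size C c) (3 + s)) (≤-reflexive (sym size≡))
          len≤ = ≤-trans (<⇒≤ (length<size A xs)) (≤-trans (m≤n+m _ (size Γ γ)) s≤)
          t , r , t≤ = loop-runs γ s m xs c ≤-refl ≤-refl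
      in t , r , weaken t≤
           (suc′ (base len≤) *′
            suc′ (power (suc′ (suc′ (suc′ (base s≤ +′ (base c≤ +′ base len≤ *′ power (base 2+s≤) growth))))) (deg body)))

  fold : Γ ⊗ (list A ⊗ C) ⟶ C
  fold = record { fun = fold-fun ; prog = loop (prog body) ; polyTime = fold-polyTime }

-- Keeps the denotations in readable form, so that compound programs compute to the intended list
-- expressions by conversion.
recast : (f : A ⟶ B) (g : ⟦ A ⟧ → ⟦ B ⟧) → (∀ x → fun f x ≡ g x) → A ⟶ B
recast f g f≗g = record
  { fun      = g
  ; prog     = prog f
  ; polyTime = deg f , λ x → subst (λ y → ∃[ t ] Run (prog f) x y t × t ≤ _ ^′ deg f) (f≗g x) (runs f x)
  }

foldTails-∷ : ∀ {A : Set} (xs ys : List A) → foldTails (λ x _ → x ∷_) xs ys ≡ xs ʳ++ ys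
foldTails-∷ []       ys = refl
foldTails-∷ (x ∷ xs) ys = foldTails-∷ xs (x ∷ ys)

foldTails-suc : ∀ {A : Set} (xs : List A) n → foldTails (λ _ _ → suc) xs n ≡ length xs + n
foldTails-suc []       n = refl
foldTails-suc (x ∷ xs) n = trans (foldTails-suc xs (suc n)) (+-suc (length xs) n)

ʳ++⟶ : list A ⊗ list A ⟶ list A
ʳ++⟶ {A} = recast ((ι bang ▵ ι id) ⋙ Fold.fold (((p₁ ⋙ p₂ ⋙ p₁) ▵ p₂) ⋙ ι cons) 1 grows) _
                   λ (xs , ys) → foldTails-∷ xs ys
  where
  grows : ∀ (γ : ⟦ unit ⟧) x xs c →
          size (list A) (x ∷ c) ≤ size (list A) c + suc (size (unit ⊗ (A ⊗ list A)) (γ , x , xs)) ^ 1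
  grows _ x xs c = begin
    suc (suc (size A x) + _)                ≡⟨ cong suc (+-comm (suc (size A x)) _) ⟩
    size (list A) c + suc (size A x)        ≤⟨ +-monoʳ-≤ (size (list A) c)
                                                 (≤-trans (≤-trans (s≤s (m≤m+n (size A x) _)) (m≤n+m _ 3)) (m≤m*n _ 1)) ⟩
    _                                       ∎
    where open ≤-Reasoning

-- Incrementing a binary number adds at most one digit, hence growth exponent 0.
length⟶ : list A ⟶ nat
length⟶ {A} = recast ((ι bang ▵ (ι id ▵ ι (lit 0))) ⋙ Fold.fold ((ι (lit 1) ▵ p₂) ⋙ ι add) 0 grows) length
                      λ xs → trans (foldTails-suc xs 0) (+-identityʳ (length xs))
  where
  grows : ∀ (γ : ⟦ unit ⟧) x xs c →
          size nat (suc c) ≤ size nat c + suc (size (unit ⊗ (A ⊗ list A)) (γ , x , xs)) ^ 0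
  grows _ x xs c = ≤-trans (size-suc c) (≤-reflexive (+-comm 1 _))

-- The accumulator reverses the order, which is immaterial: the result matters only as a set.
forTails : ∀ {A B : Set} → List A → (A → List A → List B) → List B
forTails xs g = foldTails (λ x xs ys → g x xs ʳ++ ys) xs []

-- Opaque, so that unification can recover the body of a loop.
opaque
  forEach : ∀ {A B : Set} → List A → (A → List B) → List B
  forEach xs g = forTails xs λ x _ → g x

  forTails≡forEach : ∀ {A B : Set} (xs : List A) (g : A → List B) → forTails xs (λ x _ → g x) ≡ forEach xs g
  forTails≡forEach xs g = refl

opaque
  enumerate : ∀ {A : Set} → List A → List (ℕ × A)
  enumerate xs = forTails xs λ x xs → (length xs , x) ∷ []

  forTails≡enumerate : ∀ {A : Set} (xs : List A) → forTails xs (λ x xs → (length xs , x) ∷ []) ≡ enumerate xs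
  forTails≡enumerate xs = refl

-- The list produced in one pass does not depend on the accumulator, so the degree of the body can
-- serve as the growth exponent; this allows loops to be nested.
forTails⟶ : Γ ⟶ list A → Γ ⊗ (A ⊗ list A) ⟶ list B → Γ ⟶ list B
forTails⟶ {Γ} {A} {B} xs g =
  (ι id ▵ (xs ▵ ι nil)) ⋙ Fold.fold (((p₁ ⋙ g) ▵ p₂) ⋙ ʳ++⟶) (deg g) grows
  where
  grows : ∀ γ x xs c → size (list B) (fun g (γ , x , xs) ʳ++ c) ≤
                       size (list B) c + suc (size (Γ ⊗ (A ⊗ list A)) (γ , x , xs)) ^ deg g
  grows γ x xs c = ≤-trans (size-ʳ++ B (fun g (γ , x , xs)) c)
                           (+-monoʳ-≤ (size (list B) c) (bound (size-fun g (γ , x , xs))))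

forEach⟶ : Γ ⟶ list A → Γ ⊗ A ⟶ list B → Γ ⟶ list B
forEach⟶ xs g = recast (forTails⟶ xs ((p₁ ▵ (p₂ ⋙ p₁)) ⋙ g))
                       (λ γ → forEach (fun xs γ) λ x → fun g (γ , x))
                       (λ γ → forTails≡forEach (fun xs γ) λ x → fun g (γ , x))

singleton⟶ : Γ ⟶ A → Γ ⟶ list A
singleton⟶ x = (x ▵ ι nil) ⋙ ι cons

enumerate⟶ : Γ ⟶ list A → Γ ⟶ list (nat ⊗ A)
enumerate⟶ xs = recast (forTails⟶ xs (singleton⟶ ((p₂ ⋙ p₂ ⋙ length⟶) ▵ (p₂ ⋙ p₁))))
                       (λ γ → enumerate (fun xs γ)) (λ γ → forTails≡enumerate (fun xs γ))

let⟶ : Γ ⟶ A → Γ ⊗ A ⟶ B → Γ ⟶ B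
let⟶ x f = (ι id ▵ x) ⋙ f

infixl 6 _+⟶_ _∸⟶_
infixl 7 _*⟶_
_+⟶_ _*⟶_ _∸⟶_ : Γ ⟶ nat → Γ ⟶ nat → Γ ⟶ nat
f +⟶ g = (f ▵ g) ⋙ ι add
f *⟶ g = (f ▵ g) ⋙ ι mul
f ∸⟶ g = (f ▵ g) ⋙ ι sub

infixr 5 _ʳ++ᵖ_
_ʳ++ᵖ_ : Γ ⟶ list A → Γ ⟶ list A → Γ ⟶ list A
f ʳ++ᵖ g = (f ▵ g) ⋙ ʳ++⟶

case⟶ : Γ ⟶ A ⊕ B → Γ ⊗ A ⟶ C → Γ ⊗ B ⟶ C → Γ ⟶ C
case⟶ {Γ} {A} {B} {C} s f g =
  recast ((s ▵ ι id) ⋙ ι dist ⋙ (((p₂ ▵ p₁) ⋙ f) ▿ ((p₂ ▵ p₁) ⋙ g)))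
         (λ γ → branch γ (fun s γ))
         (λ γ → branch-dist γ (fun s γ))
  where
  branch : ⟦ Γ ⟧ → ⟦ A ⊕ B ⟧ → ⟦ C ⟧
  branch γ = [ (λ x → fun f (γ , x)) , (λ y → fun g (γ , y)) ]′
  branch-dist : ∀ γ z → [ (λ (x , γ) → fun f (γ , x)) , (λ (y , γ) → fun g (γ , y)) ]′ (apply dist (z , γ)) ≡ branch γ z
  branch-dist γ (inj₁ x) = refl
  branch-dist γ (inj₂ y) = refl

-- Membership in computed lists

-- The tail `xs` behind the occurrence is recorded because its length is the label that `enumerate`
-- assigns.
data Occurs {A : Set} (x : A) (xs : List A) : List A → Set where
  here  : Occurs x xs (x ∷ xs)
  there : ∀ {y ys} → Occurs x xs ys → Occurs x xs (y ∷ ys)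

module _ {A B : Set} (g : A → List A → List B) {y : B} where

  private
    collect : List A → List B → List B
    collect = foldTails (λ x xs ys → g x xs ʳ++ ys)

    collect⁺ˡ : ∀ ys acc → y ∈ˡ acc → y ∈ˡ collect ys acc
    collect⁺ˡ []       acc y∈ = y∈
    collect⁺ˡ (x ∷ ys) acc y∈ = collect⁺ˡ ys _ (reverseAcc⁺ acc (g x ys) (inj₁ y∈))

    collect⁺ʳ : ∀ {x xs ys} acc → Occurs x xs ys → y ∈ˡ g x xs → y ∈ˡ collect ys acc
    collect⁺ʳ {x} {xs} acc here      y∈ = collect⁺ˡ xs _ (reverseAcc⁺ acc (g x xs) (inj₂ y∈))
    collect⁺ʳ          acc (there o) y∈ = collect⁺ʳ _ o y∈

    collect⁻ : ∀ ys acc → y ∈ˡ collect ys acc →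
               y ∈ˡ acc ⊎ ∃[ x ] ∃[ xs ] Occurs x xs ys × y ∈ˡ g x xs
    collect⁻ []       acc y∈ = inj₁ y∈
    collect⁻ (x ∷ ys) acc y∈ with collect⁻ ys _ y∈
    ... | inj₂ (x′ , xs , o , y∈g) = inj₂ (x′ , xs , there o , y∈g)
    ... | inj₁ y∈acc with reverseAcc⁻ acc (g x ys) y∈acc
    ...   | inj₁ y∈acc′ = inj₁ y∈acc′
    ...   | inj₂ y∈g    = inj₂ (x , ys , here , y∈g)

  ∈-forTails⁺ : ∀ {x xs ys} → Occurs x xs ys → y ∈ˡ g x xs → y ∈ˡ forTails ys g
  ∈-forTails⁺ = collect⁺ʳ []

  ∈-forTails⁻ : ∀ ys → y ∈ˡ forTails ys g → ∃[ x ] ∃[ xs ] Occurs x xs ys × y ∈ˡ g x xs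
  ∈-forTails⁻ ys y∈ with inj₂ r ← collect⁻ ys [] y∈ = r

∈⇒Occurs : ∀ {A : Set} {x : A} {xs} → x ∈ˡ xs → ∃[ ys ] Occurs x ys xs
∈⇒Occurs (here refl) = _ , here
∈⇒Occurs (there x∈) with ys , o ← ∈⇒Occurs x∈ = ys , there o

Occurs⇒∈ : ∀ {A : Set} {x : A} {ys xs} → Occurs x ys xs → x ∈ˡ xs
Occurs⇒∈ here      = here refl
Occurs⇒∈ (there o) = there (Occurs⇒∈ o)

module _ {A B : Set} {g : A → List B} {y : B} where

  ∈-forEach⁺ : ∀ {x xs} → x ∈ˡ xs → y ∈ˡ g x → y ∈ˡ forEach xs g
  ∈-forEach⁺ {xs = xs} x∈ y∈ =
    subst (y ∈ˡ_) (forTails≡forEach xs g) (∈-forTails⁺ (λ x _ → g x) (proj₂ (∈⇒Occurs x∈)) y∈)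

  ∈-forEach⁻ : ∀ {xs} → y ∈ˡ forEach xs g → ∃[ x ] x ∈ˡ xs × y ∈ˡ g x
  ∈-forEach⁻ {xs} y∈
    with x , _ , o , y∈g ← ∈-forTails⁻ (λ x _ → g x) xs (subst (y ∈ˡ_) (sym (forTails≡forEach xs g)) y∈)
    = x , Occurs⇒∈ o , y∈g

map-forEach : ∀ {A B C : Set} (f : B → C) (g : A → List B) xs →
              map f (forEach xs g) ≡ forEach xs (map f ∘ g)
map-forEach {A} {B} f g xs =
  trans (cong (map f) (sym (forTails≡forEach xs g))) (trans (go xs []) (forTails≡forEach xs (map f ∘ g)))
  where
  go : ∀ xs (ys : List B) →
       map f (foldTails (λ x _ ys → g x ʳ++ ys) xs ys) ≡ foldTails (λ x _ ys → map f (g x) ʳ++ ys) xs (map f ys)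
  go []       ys = refl
  go (x ∷ xs) ys = trans (go xs (g x ʳ++ ys))
                         (cong (foldTails _ xs) (map-ʳ++ f (g x)))

-- Counted from the end, since inside a loop only the remaining list is at hand.
label : ∀ {n} → Fin n → ℕ
label = toℕ ∘ opposite

label< : ∀ {n} (u : Fin n) → label u < n
label< u = Finₚ.toℕ<n (opposite u)

label-injective : ∀ {n} {u v : Fin n} → label u ≡ label v → u ≡ v
label-injective {u = u} {v} eq =
  trans (sym (Finₚ.opposite-involutive u))
        (trans (cong opposite (toℕ-injective eq)) (Finₚ.opposite-involutive v))

module _ {A : Set} where

  Occurs-tabulate⁺ : ∀ {n} (f : Fin n → A) i → ∃[ xs ] Occurs (f i) xs (tabulate f) × length xs ≡ label i
  Occurs-tabulate⁺ {suc n} f zero    = _ , here , trans (length-tabulate (f ∘ suc)) (sym (toℕ-fromℕ n))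
  Occurs-tabulate⁺ {suc n} f (suc i) with xs , o , len ← Occurs-tabulate⁺ (f ∘ suc) i =
    xs , there o , trans len (sym (toℕ-inject₁ (opposite i)))

  Occurs-tabulate⁻ : ∀ {n} (f : Fin n → A) {x xs} → Occurs x xs (tabulate f) →
                     ∃[ i ] x ≡ f i × length xs ≡ label i
  Occurs-tabulate⁻ {suc n} f here      = zero , refl , trans (length-tabulate (f ∘ suc)) (sym (toℕ-fromℕ n))
  Occurs-tabulate⁻ {suc n} f (there o) with i , eq , len ← Occurs-tabulate⁻ (f ∘ suc) o =
    suc i , eq , trans len (sym (toℕ-inject₁ (opposite i)))

  ∈-enumerate⁺ : ∀ {x : A} {xs ys} → Occurs x xs ys → (length xs , x) ∈ˡ enumerate ys
  ∈-enumerate⁺ {ys = ys} o =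
    subst (_ ∈ˡ_) (forTails≡enumerate ys) (∈-forTails⁺ (λ x xs → (length xs , x) ∷ []) o (here refl))

  ∈-enumerate⁻ : ∀ {p} {ys : List A} → p ∈ˡ enumerate ys →
                 ∃[ x ] ∃[ xs ] Occurs x xs ys × p ≡ (length xs , x)
  ∈-enumerate⁻ {ys = ys} p∈
    with x , xs , o , here eq ← ∈-forTails⁻ (λ x xs → (length xs , x) ∷ []) ys
                                  (subst (_ ∈ˡ_) (sym (forTails≡enumerate ys)) p∈)
    = x , xs , o , eq

  ∈-enumerate-tabulate⁺ : ∀ {n} (f : Fin n → A) i → (label i , f i) ∈ˡ enumerate (tabulate f)
  ∈-enumerate-tabulate⁺ f i with xs , o , len ← Occurs-tabulate⁺ f i =
    subst (λ a → (a , f i) ∈ˡ enumerate (tabulate f)) len (∈-enumerate⁺ o)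

  ∈-enumerate-tabulate⁻ : ∀ {n} (f : Fin n → A) {p} → p ∈ˡ enumerate (tabulate f) → ∃[ i ] p ≡ (label i , f i)
  ∈-enumerate-tabulate⁻ f p∈ with x , xs , o , eq ← ∈-enumerate⁻ p∈
    with i , x≡ , len ← Occurs-tabulate⁻ f o = i , trans eq (cong₂ _,_ len x≡)

  Occurs-length : ∀ {a} {ys : List A} → a < length ys → ∃[ x ] ∃[ xs ] Occurs x xs ys × length xs ≡ a
  Occurs-length {a} {y ∷ ys} a< with a ≟ length ys
  ... | yes refl = y , ys , here , refl
  ... | no  a≢   with x , xs , o , len ← Occurs-length {a} {ys} (≤∧≢⇒< (s≤s⁻¹ a<) a≢) = x , xs , there o , len

-- Subsets of finite sets

enumerateSubset : ∀ {n} (p : Subset n) → Fin ∣ p ∣ → Fin n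
enumerateSubset (inside  ∷ p) zero    = zero
enumerateSubset (inside  ∷ p) (suc i) = suc (enumerateSubset p i)
enumerateSubset (outside ∷ p) i       = suc (enumerateSubset p i)

enumerateSubset-∈ : ∀ {n} (p : Subset n) i → enumerateSubset p i ∈ p
enumerateSubset-∈ (inside  ∷ p) zero    = here
enumerateSubset-∈ (inside  ∷ p) (suc i) = there (enumerateSubset-∈ p i)
enumerateSubset-∈ (outside ∷ p) i       = there (enumerateSubset-∈ p i)

enumerateSubset-injective : ∀ {n} (p : Subset n) → Injective _≡_ _≡_ (enumerateSubset p)
enumerateSubset-injective (inside  ∷ p) {zero}  {zero}  eq = refl
enumerateSubset-injective (inside  ∷ p) {suc i} {suc j} eq =
  cong suc (enumerateSubset-injective p (Finₚ.suc-injective eq))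
enumerateSubset-injective (outside ∷ p) eq = enumerateSubset-injective p (Finₚ.suc-injective eq)

enumerateSubset-surjective : ∀ {n} {p : Subset n} {x} → x ∈ p → ∃[ i ] enumerateSubset p i ≡ x
enumerateSubset-surjective {p = inside ∷ p} here = zero , refl
enumerateSubset-surjective {p = inside ∷ p} (there x∈) with i , refl ← enumerateSubset-surjective x∈ = suc i , refl
enumerateSubset-surjective {p = outside ∷ p} (there x∈) with i , refl ← enumerateSubset-surjective x∈ = i , refl

module _ {m n : ℕ} (f : Fin m → Fin n) where

  image : Subset n
  image = Vec.tabulate λ x → does (any? λ i → f i Fin.≟ x)

  ∈-image⁺ : ∀ i → f i ∈ image
  ∈-image⁺ i = lookup⇒[]= (f i) image (trans (lookup∘tabulate _ (f i)) (dec-true (any? λ j → f j Fin.≟ f i) (i , refl)))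

  ∈-image⁻ : ∀ {x} → x ∈ image → ∃[ i ] f i ≡ x
  ∈-image⁻ {x} x∈ with any? (λ i → f i Fin.≟ x) | trans (sym (lookup∘tabulate _ x)) ([]=⇒lookup x∈)
  ... | yes r | _ = r

  module _ (f-injective : Injective _≡_ _≡_ f) where

    -- Preimages and positions in the enumeration of the image give injections in both directions.
    ∣image∣≡ : ∣ image ∣ ≡ m
    ∣image∣≡ = ≤-antisym (injective⇒≤ preimage-injective) (injective⇒≤ position-injective)
      where
      preimage : ∀ i → ∃[ j ] f j ≡ enumerateSubset image i
      preimage i = ∈-image⁻ (enumerateSubset-∈ image i)
      preimage-injective : Injective _≡_ _≡_ (proj₁ ∘ preimage)
      preimage-injective {i} {j} eq = enumerateSubset-injective image
        (trans (sym (proj₂ (preimage i))) (trans (cong f eq) (proj₂ (preimage j))))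
      position : ∀ j → ∃[ i ] enumerateSubset image i ≡ f j
      position j = enumerateSubset-surjective (∈-image⁺ j)
      position-injective : Injective _≡_ _≡_ (proj₁ ∘ position)
      position-injective {i} {j} eq = f-injective
        (trans (sym (proj₂ (position i))) (trans (cong (enumerateSubset image) eq) (proj₂ (position j))))

    -- An element missed by `f` would make the image a proper subset of `p` of the same cardinality.
    injective⇒onto : ∀ {p} → (∀ i → f i ∈ p) → ∣ p ∣ ≡ m → ∀ {x} → x ∈ p → ∃[ i ] f i ≡ x
    injective⇒onto {p} f∈p ∣p∣≡m {x} x∈p with any? (λ i → f i Fin.≟ x)
    ... | yes r = r
    ... | no ¬r = contradiction
      (p⊂q⇒∣p∣<∣q∣ {p = image} {p}
        ((λ y∈ → let i , eq = ∈-image⁻ y∈ in subst (_∈ p) eq (f∈p i)) , x , x∈p , ¬r ∘ ∈-image⁻))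
      (<-irrefl (trans ∣image∣≡ (sym ∣p∣≡m)))

-- Intervals on a line

-- Two closed intervals of length N with left endpoints a and b meet.
Overlap : ℕ → ℕ → ℕ → Set
Overlap N a b = a ≤ b + N × b ≤ a + N

-- Offsets are at most 3N, so regions 5N apart do not interact.
coordinate : ℕ → ℕ × ℕ → ℕ
coordinate N (r , o) = 5 * N * r + o

module _ {N : ℕ} (1≤N : 1 ≤ N) where

  private
    later : ∀ {r o r′ o′} → o ≤ 3 * N → r < r′ → ¬ (coordinate N (r′ , o′) ≤ coordinate N (r , o) + N)
    later {r} {o} {r′} {o′} o≤ r<r′ le = <-irrefl refl (begin-strict
      5 * N * r + 4 * N            <⟨ +-monoʳ-< (5 * N * r) (*-monoˡ-< N {{>-nonZero 1≤N}} (n<1+n 4)) ⟩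
      5 * N * r + 5 * N            ≡⟨ +-comm (5 * N * r) (5 * N) ⟩
      5 * N + 5 * N * r            ≡⟨ *-suc (5 * N) r ⟨
      5 * N * suc r                ≤⟨ *-monoʳ-≤ (5 * N) r<r′ ⟩
      5 * N * r′                   ≤⟨ m≤m+n _ o′ ⟩
      5 * N * r′ + o′              ≤⟨ le ⟩
      5 * N * r + o + N            ≡⟨ +-assoc (5 * N * r) o N ⟩
      5 * N * r + (o + N)          ≤⟨ +-monoʳ-≤ (5 * N * r) (≤-trans (+-monoˡ-≤ N o≤) (≤-reflexive (+-comm (3 * N) N))) ⟩
      5 * N * r + 4 * N            ∎)
      where open ≤-Reasoning

  overlap-coordinate⁻ : ∀ {r o r′ o′} → o ≤ 3 * N → o′ ≤ 3 * N →
    Overlap N (coordinate N (r , o)) (coordinate N (r′ , o′)) → r ≡ r′ × Overlap N o o′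
  overlap-coordinate⁻ {r} {o} {r′} {o′} o≤ o′≤ (le , ge) with <-cmp r r′
  ... | tri< r<r′ _ _ = contradiction ge (later {o′ = o′} o≤ r<r′)
  ... | tri> _ _ r>r′ = contradiction le (later {o′ = o} o′≤ r>r′)
  ... | tri≈ _ refl _ = refl , cancel le , cancel ge
    where
    cancel : ∀ {a b} → 5 * N * r + a ≤ 5 * N * r + b + N → a ≤ b + N
    cancel {a} {b} p = +-cancelˡ-≤ (5 * N * r) a (b + N) (≤-trans p (≤-reflexive (+-assoc (5 * N * r) b N)))

overlap-coordinate⁺ : ∀ N r {o o′} → Overlap N o o′ → Overlap N (coordinate N (r , o)) (coordinate N (r , o′))
overlap-coordinate⁺ N r {o} {o′} (le , ge) = shift o o′ le , shift o′ o ge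
  where
  shift : ∀ a b → a ≤ b + N → 5 * N * r + a ≤ 5 * N * r + b + N
  shift a b a≤ = ≤-trans (+-monoʳ-≤ (5 * N * r) a≤) (≤-reflexive (sym (+-assoc (5 * N * r) b N)))

module _ (n : ℕ) where

  private
    -- `mkℚᵘ` takes the denominator less one, so the value is a / (n + 1), and unit length amounts
    -- to n + 1 steps.
    frac : ℕ → ℚᵘ
    frac a = mkℚᵘ (ℤ.+ a) n

    frac-mono : ∀ {a b} → a ≤ b → frac a ℚᵘ.≤ frac b
    frac-mono a≤b = *≤* (ℤₚ.*-monoʳ-≤-nonNeg (ℤ.+ suc n) (ℤ.+≤+ a≤b))

    frac-cancel : ∀ {a b} → frac a ℚᵘ.≤ frac b → a ≤ b
    frac-cancel (*≤* p) = ℤₚ.drop‿+≤+ (ℤₚ.*-cancelʳ-≤-pos _ _ (ℤ.+ suc n) p)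

    frac+1 : ∀ a → frac a ℚᵘ.+ 1ℚᵘ ≃ frac (a + suc n)
    frac+1 a = *≡* (cong₂ ℤ._*_
      (cong₂ ℤ._+_ (ℤₚ.*-identityʳ (ℤ.+ a)) (ℤₚ.*-identityˡ (ℤ.+ suc n)))
      (cong ℤ.+_ (sym (*-identityʳ (suc n)))))

  -- The larger of the two left endpoints is a common point.
  unitInterval-meets⁺ : ∀ {a b} → Overlap (suc n) a b → unitInterval (frac a) ≬ unitInterval (frac b)
  unitInterval-meets⁺ {a} {b} (a≤ , b≤) with ≤-total a b
  ... | inj₁ a≤b = frac b , (frac-mono a≤b , ℚᵘₚ.≤-respʳ-≃ (ℚᵘₚ.≃-sym (frac+1 a)) (frac-mono b≤)) ,
                   (ℚᵘₚ.≤-refl , ℚᵘₚ.≤-respʳ-≃ (ℚᵘₚ.≃-sym (frac+1 b)) (frac-mono (m≤m+n b _)))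
  ... | inj₂ b≤a = frac a , (ℚᵘₚ.≤-refl , ℚᵘₚ.≤-respʳ-≃ (ℚᵘₚ.≃-sym (frac+1 a)) (frac-mono (m≤m+n a _))) ,
                   (frac-mono b≤a , ℚᵘₚ.≤-respʳ-≃ (ℚᵘₚ.≃-sym (frac+1 b)) (frac-mono a≤))

  unitInterval-meets⁻ : ∀ {a b} → unitInterval (frac a) ≬ unitInterval (frac b) → Overlap (suc n) a b
  unitInterval-meets⁻ {a} {b} (x , (a≤x , x≤a+1) , (b≤x , x≤b+1)) =
    frac-cancel (ℚᵘₚ.≤-respʳ-≃ (frac+1 b) (ℚᵘₚ.≤-trans a≤x x≤b+1)) ,
    frac-cancel (ℚᵘₚ.≤-respʳ-≃ (frac+1 a) (ℚᵘₚ.≤-trans b≤x x≤a+1))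

-- The construction and its program

-- A region and an offset in it, on each track.
Position : Ty
Position = (nat ⊗ nat) ⊗ (nat ⊗ nat)

vertexLabels : ∀ {A : Set} → List A → List ℕ
vertexLabels rows = forEach (enumerate rows) λ (a , _) → a ∷ []

edgeLabels : ∀ {A B : Set} → List (List (A ⊎ B)) → List (ℕ × ℕ)
edgeLabels rows =
  forEach (enumerate rows) λ (a , row) →
  forEach (enumerate row) λ (b , entry) →
  [ (λ _ → []) , (λ _ → (a , b) ∷ []) ]′ entry

-- The loops traverse lists, so the numbers below K are filtered out of the labels of a list that is
-- long enough; `unsuc` of K ∸ a tests whether a < K.
cellLabels : ∀ {A : Set} → ℕ → List A → List ℕ
cellLabels K xs =
  forEach (enumerate xs) λ (a , _) →
  [ (λ _ → []) , (λ _ → a ∷ []) ]′ (apply unsuc (K ∸ a))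

vertexLabels⟶ : Γ ⟶ list A → Γ ⟶ list nat
vertexLabels⟶ rows = forEach⟶ (enumerate⟶ rows) (singleton⟶ (p₂ ⋙ p₁))

edgeLabels⟶ : Γ ⟶ list (list (A ⊕ B)) → Γ ⟶ list (nat ⊗ nat)
edgeLabels⟶ rows =
  forEach⟶ (enumerate⟶ rows)
    (forEach⟶ (enumerate⟶ (p₂ ⋙ p₂))
      (case⟶ (p₂ ⋙ p₂) (ι nil) (singleton⟶ ((p₁ ⋙ p₁ ⋙ p₂ ⋙ p₁) ▵ (p₁ ⋙ p₂ ⋙ p₁)))))

cellLabels⟶ : Γ ⟶ nat → Γ ⟶ list A → Γ ⟶ list nat
cellLabels⟶ K xs =
  forEach⟶ (enumerate⟶ xs)
    (case⟶ (((p₁ ⋙ K) ∸⟶ (p₂ ⋙ p₁)) ⋙ ι unsuc) (ι nil) (singleton⟶ (p₁ ⋙ p₂ ⋙ p₁)))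

cell : ℕ → ℕ → ℕ → ℕ
cell K i j = K * i + j

-- On track 2 each cell has three regions, so that the two guards get one of their own.
module _ (N K : ℕ) where

  choiceAt : ℕ → ℕ → ℕ → ℕ → ⟦ Position ⟧
  choiceAt i j a b = (cell K i j , N + a) , (3 * cell K i j + 0 , N + b)

  -- On track 1 the two offsets are N + 1 apart, so the guards of a cell miss each other, yet both
  -- are within N of every choice, as these lie between N and 2N - 2.
  guardˡAt guardʳAt : ℕ → ℕ → ⟦ Position ⟧
  guardˡAt i j = (cell K i j , N ∸ 1) , (3 * cell K i j + 1 , 0)
  guardʳAt i j = (cell K i j , 2 * N) , (3 * cell K i j + 2 , 0)

  tieˡAt tieʳAt : ℕ → ℕ → ℕ → ℕ → ⟦ Position ⟧
  tieˡAt i j l q = (cell K i j , q) , (3 * cell K l i + 0 , 2 * N + 1 + q)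
  tieʳAt i j l q = (cell K i j , 2 * N + 1 + q) , (3 * cell K l i + 0 , q)

  module _ (cs vs : List ℕ) (es : List (ℕ × ℕ)) where

    diagonalChoices edgeChoices guards ties positions : List ⟦ Position ⟧
    diagonalChoices = forEach cs λ i → forEach vs λ a → choiceAt i i a a ∷ []
    edgeChoices     = forEach cs λ i → forEach cs λ j → forEach es λ (a , b) → choiceAt i j a b ∷ []
    guards          = forEach cs λ i → forEach cs λ j → guardˡAt i j ∷ guardʳAt i j ∷ []
    ties            = forEach cs λ i → forEach cs λ j → forEach cs λ l → forEach vs λ q →
                      tieˡAt i j l q ∷ tieʳAt i j l q ∷ []
    positions       = diagonalChoices ʳ++ edgeChoices ʳ++ guards ʳ++ ties

cell⟶ : Γ ⟶ nat → Γ ⟶ nat → Γ ⟶ nat → Γ ⟶ nat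
cell⟶ K i j = K *⟶ i +⟶ j

slot⟶ : Γ ⟶ nat → ℕ → Γ ⟶ nat
slot⟶ c ε = ι (lit 3) *⟶ c +⟶ ι (lit ε)

infix 8 ↑_
↑_ : Γ ⟶ B → Γ ⊗ A ⟶ B
↑ f = p₁ ⋙ f

positions⟶ : Γ ⟶ nat → Γ ⟶ nat → Γ ⟶ list nat → Γ ⟶ list nat → Γ ⟶ list (nat ⊗ nat) → Γ ⟶ list Position
positions⟶ N K cs vs es =
  (forEach⟶ cs (forEach⟶ (↑ vs)
    (let i = ↑ p₂ ; a = p₂ ; c = cell⟶ (↑ ↑ K) i i in
     singleton⟶ ((c ▵ (↑ ↑ N +⟶ a)) ▵ (slot⟶ c 0 ▵ (↑ ↑ N +⟶ a)))))) ʳ++ᵖ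
  (forEach⟶ cs (forEach⟶ (↑ cs) (forEach⟶ (↑ ↑ es)
    (let i = ↑ ↑ p₂ ; j = ↑ p₂ ; a = p₂ ⋙ p₁ ; b = p₂ ⋙ p₂ ; c = cell⟶ (↑ ↑ ↑ K) i j in
     singleton⟶ ((c ▵ (↑ ↑ ↑ N +⟶ a)) ▵ (slot⟶ c 0 ▵ (↑ ↑ ↑ N +⟶ b))))))) ʳ++ᵖ
  (forEach⟶ cs (forEach⟶ (↑ cs)
    (let i = ↑ p₂ ; j = p₂ ; c = cell⟶ (↑ ↑ K) i j in
     (((c ▵ (↑ ↑ N ∸⟶ ι (lit 1))) ▵ (slot⟶ c 1 ▵ ι (lit 0))) ▵
      singleton⟶ ((c ▵ (ι (lit 2) *⟶ ↑ ↑ N)) ▵ (slot⟶ c 2 ▵ ι (lit 0)))) ⋙ ι cons))) ʳ++ᵖ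
  (forEach⟶ cs (forEach⟶ (↑ cs) (forEach⟶ (↑ ↑ cs) (forEach⟶ (↑ ↑ ↑ vs)
    (let i = ↑ ↑ ↑ p₂ ; j = ↑ ↑ p₂ ; l = ↑ p₂ ; q = p₂
         K′ = ↑ ↑ ↑ ↑ K ; q′ = (ι (lit 2) *⟶ ↑ ↑ ↑ ↑ N) +⟶ ι (lit 1) +⟶ q
         c = cell⟶ K′ i j ; d = slot⟶ (cell⟶ K′ l i) 0 in
     (((c ▵ q) ▵ (d ▵ q′)) ▵ singleton⟶ ((c ▵ q′) ▵ (d ▵ q))) ⋙ ι cons)))))

coordinate⟶ : Γ ⟶ nat → Γ ⟶ nat ⊗ nat → Γ ⟶ nat
coordinate⟶ N s = ι (lit 5) *⟶ N *⟶ (s ⋙ p₁) +⟶ (s ⋙ p₂)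

place : ℕ → ⟦ Position ⟧ → Unit2TrackInterval
place n (s , t) = mkℚᵘ (ℤ.+ coordinate (suc n) s) n ∣∣ mkℚᵘ (ℤ.+ coordinate (suc n) t) n

place⟶ : Γ ⟶ nat → Γ ⟶ Position → Γ ⟶ ((nat ⊕ nat) ⊗ nat) ⊗ ((nat ⊕ nat) ⊗ nat)
place⟶ N p = (((coordinate⟶ N (p ⋙ p₁)) ⋙ ι inl) ▵ N) ▵ (((coordinate⟶ N (p ⋙ p₂)) ⋙ ι inl) ▵ N)

-- The minimum of k and n + 1: as k is given in binary, the K² cells could otherwise
-- outnumber every polynomial in the input size.
cliqueSize : ℕ → ℕ → ℕ
cliqueSize n k = k ∸ (k ∸ suc n)

module _ (n K : ℕ) (rows : List (List ⟦ unit ⊕ unit ⟧)) where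

  layout : List ⟦ Position ⟧
  -- The additional entry provides n + 1 labels, enough for every K up to the cap n + 1.
  layout = positions (suc n) K (cellLabels K ([] ∷ rows)) (vertexLabels rows) (edgeLabels rows)

  family : List Unit2TrackInterval
  family = forEach layout λ p → place n p ∷ []

opaque
  reduction : list (list (unit ⊕ unit)) ⊗ nat ⟶ list (((nat ⊕ nat) ⊗ nat) ⊗ ((nat ⊕ nat) ⊗ nat)) ⊗ nat
  reduction =
    let⟶ (ι (lit 1) +⟶ (p₁ ⋙ length⟶))
    (let⟶ ((p₁ ⋙ p₂) ∸⟶ ((p₁ ⋙ p₂) ∸⟶ p₂))
    (let rows = p₁ ⋙ p₁ ⋙ p₁ ; N = p₁ ⋙ p₂ ; K = p₂ in
     forEach⟶
       (positions⟶ N K (cellLabels⟶ K ((ι nil ▵ rows) ⋙ ι cons)) (vertexLabels⟶ rows) (edgeLabels⟶ rows))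
       (singleton⟶ (place⟶ (↑ N) p₂))
     ▵ (K *⟶ K)))

  -- The program emits encoded intervals directly. Once the encoding is moved inside the loop, the
  -- two sides agree by conversion.
  reduction-fun : ∀ {n} rows k → length rows ≡ n → let K = cliqueSize n k in
    fun reduction (rows , k) ≡ (map encodeUnit2TrackInterval (family n K rows) , K * K)
  reduction-fun rows k refl =
    cong (_, K * K) (sym (map-forEach encodeUnit2TrackInterval (λ p → place n p ∷ []) (layout n K rows)))
    where
    n K : ℕ
    n = length rows
    K = cliqueSize n k

-- Correctness of the construction

-- Closed adjacency: unlike Adj, a position is near itself.
Near : ℕ → ⟦ Position ⟧ → ⟦ Position ⟧ → Set
Near N ((r , a) , (s , b)) ((r′ , a′) , (s′ , b′)) =
  (r ≡ r′ × Overlap N a a′) ⊎ (s ≡ s′ × Overlap N b b′)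

OffsetsBounded : ℕ → ⟦ Position ⟧ → Set
OffsetsBounded N ((_ , a) , (_ , b)) = a ≤ 3 * N × b ≤ 3 * N

module _ (n : ℕ) where

  open Unit2TrackInterval using (points)

  near⇒meet : ∀ p q → Near (suc n) p q → points (place n p) ≬ points (place n q)
  near⇒meet ((r , _) , _) (_ , _) (inj₁ (refl , o))
    with x , x∈ ← unitInterval-meets⁺ n (overlap-coordinate⁺ (suc n) r o) = (track₁ , x) , x∈
  near⇒meet (_ , (s , _)) (_ , _) (inj₂ (refl , o))
    with x , x∈ ← unitInterval-meets⁺ n (overlap-coordinate⁺ (suc n) s o) = (track₂ , x) , x∈

  meet⇒near : ∀ p q → OffsetsBounded (suc n) p → OffsetsBounded (suc n) q →
              points (place n p) ≬ points (place n q) → Near (suc n) p q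
  meet⇒near _ _ (a≤ , _) (a′≤ , _) ((track₁ , x) , x∈) =
    inj₁ (overlap-coordinate⁻ (s≤s z≤n) a≤ a′≤ (unitInterval-meets⁻ n (x , x∈)))
  meet⇒near _ _ (_ , b≤) (_ , b′≤) ((track₂ , x) , x∈) =
    inj₂ (overlap-coordinate⁻ (s≤s z≤n) b≤ b′≤ (unitInterval-meets⁻ n (x , x∈)))

-- Arithmetic of cells, slots and offsets

remQuot-injective : ∀ {m} n {c d} → remQuot {m} n c ≡ remQuot n d → c ≡ d
remQuot-injective {m} n {c} {d} eq = begin
  c                                  ≡⟨ Finₚ.combine-remQuot {m} n c ⟨
  uncurry combine (remQuot {m} n c)  ≡⟨ cong (uncurry combine) eq ⟩
  uncurry combine (remQuot {m} n d)  ≡⟨ Finₚ.combine-remQuot {m} n d ⟩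
  d                                  ∎
  where open ≡-Reasoning

module _ {K : ℕ} where

  cell-injective : ∀ (i j i′ j′ : Fin K) → cell K (toℕ i) (toℕ j) ≡ cell K (toℕ i′) (toℕ j′) → i ≡ i′ × j ≡ j′
  cell-injective i j i′ j′ eq = Finₚ.combine-injective i j i′ j′
    (toℕ-injective (trans (Finₚ.toℕ-combine i j) (trans eq (sym (Finₚ.toℕ-combine i′ j′)))))

  -- The slot number is the mixed-radix code `combine (combine i j) ε`.
  slot-injective : ∀ (i j i′ j′ : Fin K) (ε ε′ : Fin 3) →
    3 * cell K (toℕ i) (toℕ j) + toℕ ε ≡ 3 * cell K (toℕ i′) (toℕ j′) + toℕ ε′ →
    ε ≡ ε′ × i ≡ i′ × j ≡ j′
  slot-injective i j i′ j′ ε ε′ eq =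
    let c≡ , ε≡ = Finₚ.combine-injective (combine i j) ε (combine i′ j′) ε′
                    (toℕ-injective (trans (toℕ-slot i j ε) (trans eq (sym (toℕ-slot i′ j′ ε′)))))
    in ε≡ , Finₚ.combine-injective i j i′ j′ c≡
    where
    toℕ-slot : ∀ (i j : Fin K) (ε : Fin 3) → toℕ (combine (combine i j) ε) ≡ 3 * cell K (toℕ i) (toℕ j) + toℕ ε
    toℕ-slot i j ε = trans (Finₚ.toℕ-combine (combine i j) ε) (cong (λ c → 3 * c + toℕ ε) (Finₚ.toℕ-combine i j))

module _ {N : ℕ} where

  -- Only the second inequality of `Overlap` compares labels; the first holds because q ≤ N. For
  -- `overlap-high⁺` the roles are exchanged.
  overlap-low⁺ : ∀ {q a} → a ≤ q → q ≤ N → Overlap N q (N + a)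
  overlap-low⁺ {q} {a} a≤q q≤N =
    ≤-trans q≤N (m≤n+m N (N + a)) , ≤-trans (+-monoʳ-≤ N a≤q) (≤-reflexive (+-comm N q))

  overlap-low⁻ : ∀ {q a} → Overlap N q (N + a) → a ≤ q
  overlap-low⁻ {q} {a} (_ , le) = +-cancelˡ-≤ N a q (≤-trans le (≤-reflexive (+-comm q N)))

  private
    2N+1+q≡ : ∀ (N q : ℕ) → 2 * N + 1 + q ≡ N + suc q + N
    2N+1+q≡ N q = begin-equality
      2 * N + 1 + q     ≡⟨ +-assoc (2 * N) 1 q ⟩
      2 * N + suc q     ≡⟨ cong (λ z → N + z + suc q) (+-identityʳ N) ⟩
      N + N + suc q     ≡⟨ +-assoc N N (suc q) ⟩
      N + (N + suc q)   ≡⟨ cong (N +_) (+-comm N (suc q)) ⟩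
      N + (suc q + N)   ≡⟨ +-assoc N (suc q) N ⟨
      N + suc q + N     ∎
      where open ≤-Reasoning

  overlap-high⁺ : ∀ {q a} → q < a → a ≤ N → Overlap N (2 * N + 1 + q) (N + a)
  overlap-high⁺ {q} {a} q<a a≤N =
    ≤-trans (≤-reflexive (2N+1+q≡ N q)) (+-monoˡ-≤ N (+-monoʳ-≤ N q<a)) ,
    ≤-trans (+-mono-≤ (m≤m+n N 0) a≤N) (≤-trans (≤-reflexive (cong (_+ N) (+-identityʳ N)))
      (+-monoˡ-≤ N (≤-trans (m≤m+n N (N + 0)) (≤-trans (m≤m+n (2 * N) 1) (m≤m+n (2 * N + 1) q)))))

  overlap-high⁻ : ∀ {q a} → Overlap N (2 * N + 1 + q) (N + a) → q < a
  overlap-high⁻ {q} {a} (le , _) =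
    +-cancelˡ-≤ N (suc q) a (+-cancelʳ-≤ N _ _ (≤-trans (≤-reflexive (sym (2N+1+q≡ N q))) le))

  overlap-choices : ∀ {a b} → a ≤ N → b ≤ N → Overlap N (N + a) (N + b)
  overlap-choices a≤ b≤ = one a≤ , one b≤
    where
    one : ∀ {a b} → a ≤ N → N + a ≤ N + b + N
    one {a} {b} a≤ = +-mono-≤ (m≤m+n N b) a≤

  overlap-guardʳ : ∀ {a} → a ≤ N → Overlap N (2 * N) (N + a)
  overlap-guardʳ {a} a≤ =
    ≤-trans (≤-reflexive (cong (N +_) (+-identityʳ N))) (+-monoˡ-≤ N (m≤m+n N a)) ,
    ≤-trans (+-monoʳ-≤ N a≤) (≤-trans (+-monoʳ-≤ N (m≤m+n N 0)) (m≤m+n _ N))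

overlap-guardˡ : ∀ {n a} → a < n → Overlap (suc n) n (suc n + a)
overlap-guardˡ {n} {a} a<n =
  ≤-trans (n≤1+n n) (m≤n+m (suc n) (suc n + a)) ,
  ≤-trans (≤-reflexive (sym (+-suc n a))) (+-monoʳ-≤ n (≤-trans a<n (n≤1+n n)))

-- Cliques and dominating sets, for the members as symbols

module Reduction {n : ℕ} (M : AdjacencyMatrix n) (K : ℕ) where

  open AdjacencyMatrix M

  N : ℕ
  N = suc n

  data Member : Set where
    choice        : (i j : Fin K) (u v : Fin n) → T (entry u v) ⊎ (i ≡ j × u ≡ v) → Member
    guardˡ guardʳ : (i j : Fin K) → Member
    tieˡ tieʳ     : (i j l : Fin K) (w : Fin n) → Member

  position : Member → ⟦ Position ⟧
  position (choice i j u v _) = choiceAt N K (toℕ i) (toℕ j) (label u) (label v)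
  position (guardˡ i j)       = guardˡAt N K (toℕ i) (toℕ j)
  position (guardʳ i j)       = guardʳAt N K (toℕ i) (toℕ j)
  position (tieˡ i j l w)     = tieˡAt N K (toℕ i) (toℕ j) (toℕ l) (label w)
  position (tieʳ i j l w)     = tieʳAt N K (toℕ i) (toℕ j) (toℕ l) (label w)

  label≤N : ∀ (u : Fin n) → label u ≤ N
  label≤N u = ≤-trans (<⇒≤ (label< u)) (n≤1+n n)

  offsetsBounded : ∀ m → OffsetsBounded N (position m)
  offsetsBounded (choice i j u v _) = N+≤ u , N+≤ v
    where
    N+≤ : ∀ u → N + label u ≤ 3 * N
    N+≤ u = +-monoʳ-≤ N (≤-trans (label≤N u) (m≤m+n N (N + 0)))
  offsetsBounded (guardˡ i j) = ≤-trans (n≤1+n n) (m≤m+n N (N + (N + 0))) , z≤n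
  offsetsBounded (guardʳ i j) = m≤n+m (2 * N) N , z≤n
  offsetsBounded (tieˡ i j l w) = ≤-trans (label≤N w) (m≤m+n N (N + (N + 0))) , high≤ w
    where
    -- These are the largest offsets that occur; labels are below n, so they stay within 3N.
    high≤ : ∀ w → 2 * N + 1 + label w ≤ 3 * N
    high≤ w = ≤-trans (≤-reflexive (+-assoc (2 * N) 1 (label w)))
                (≤-trans (+-monoʳ-≤ (2 * N) (≤-trans (label< w) (n≤1+n n))) (≤-reflexive (+-comm (2 * N) N)))
  offsetsBounded (tieʳ i j l w) = proj₂ (offsetsBounded (tieˡ i j l w)) , proj₁ (offsetsBounded (tieˡ i j l w))

  region : Member → Fin K × Fin K
  region (choice i j _ _ _) = i , j
  region (guardˡ i j)       = i , j
  region (guardʳ i j)       = i , j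
  region (tieˡ i j _ _)     = i , j
  region (tieʳ i j _ _)     = i , j

  proj₁-position : ∀ m → proj₁ (proj₁ (position m)) ≡ cell K (toℕ (proj₁ (region m))) (toℕ (proj₂ (region m)))
  proj₁-position (choice _ _ _ _ _) = refl
  proj₁-position (guardˡ _ _)       = refl
  proj₁-position (guardʳ _ _)       = refl
  proj₁-position (tieˡ _ _ _ _)     = refl
  proj₁-position (tieʳ _ _ _ _)     = refl

  private
    cell⇒region : ∀ i j m → cell K (toℕ i) (toℕ j) ≡ proj₁ (proj₁ (position m)) → region m ≡ (i , j)
    cell⇒region i j m eq = let i≡ , j≡ = cell-injective i j _ _ (trans eq (proj₁-position m)) in sym (cong₂ _,_ i≡ j≡)

  -- On track 2 the slots 1 and 2 of a cell hold nothing but its left and right guard, so any other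
  -- position near a guard meets it on track 1.
  near-guardˡ⇒region : ∀ i j m → Near N (position (guardˡ i j)) (position m) → region m ≡ (i , j)
  near-guardˡ⇒region i j m (inj₁ (eq , _)) = cell⇒region i j m eq
  near-guardˡ⇒region i j (choice i′ j′ _ _ _) (inj₂ (eq , _)) with () , _ ← slot-injective i j i′ j′ 1F 0F eq
  near-guardˡ⇒region i j (guardˡ i′ j′) (inj₂ (eq , _)) with _ , refl , refl ← slot-injective i j i′ j′ 1F 1F eq = refl
  near-guardˡ⇒region i j (guardʳ i′ j′) (inj₂ (eq , _)) with () , _ ← slot-injective i j i′ j′ 1F 2F eq
  near-guardˡ⇒region i j (tieˡ i′ j′ l′ _) (inj₂ (eq , _)) with () , _ ← slot-injective i j l′ i′ 1F 0F eq
  near-guardˡ⇒region i j (tieʳ i′ j′ l′ _) (inj₂ (eq , _)) with () , _ ← slot-injective i j l′ i′ 1F 0F eq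

  near-guardʳ⇒region : ∀ i j m → Near N (position (guardʳ i j)) (position m) → region m ≡ (i , j)
  near-guardʳ⇒region i j m (inj₁ (eq , _)) = cell⇒region i j m eq
  near-guardʳ⇒region i j (choice i′ j′ _ _ _) (inj₂ (eq , _)) with () , _ ← slot-injective i j i′ j′ 2F 0F eq
  near-guardʳ⇒region i j (guardˡ i′ j′) (inj₂ (eq , _)) with () , _ ← slot-injective i j i′ j′ 2F 1F eq
  near-guardʳ⇒region i j (guardʳ i′ j′) (inj₂ (eq , _)) with _ , refl , refl ← slot-injective i j i′ j′ 2F 2F eq = refl
  near-guardʳ⇒region i j (tieˡ i′ j′ l′ _) (inj₂ (eq , _)) with () , _ ← slot-injective i j l′ i′ 2F 0F eq
  near-guardʳ⇒region i j (tieʳ i′ j′ l′ _) (inj₂ (eq , _)) with () , _ ← slot-injective i j l′ i′ 2F 0F eq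

  data IsChoice (i j : Fin K) : Member → Set where
    isChoice : ∀ u v p → IsChoice i j (choice i j u v p)

  private
    n+N<2N : n + N < 2 * N
    n+N<2N = ≤-reflexive (cong (N +_) (sym (+-identityʳ N)))

  -- A guard misses its partner. A left tie, at an offset below n on track 1, ends before 2N and
  -- misses the right guard; a right tie starts beyond 2N and misses the left guard.
  near-guards⇒choice : ∀ i j m → Near N (position (guardˡ i j)) (position m) →
                       Near N (position (guardʳ i j)) (position m) → IsChoice i j m
  near-guards⇒choice i j m@(choice _ _ u v p) nˡ _ with refl ← near-guardˡ⇒region i j m nˡ = isChoice u v p
  near-guards⇒choice i j (guardˡ _ _) _ (inj₁ (_ , (le , _))) = contradiction le (<⇒≱ n+N<2N)
  near-guards⇒choice i j (guardˡ i′ j′) _ (inj₂ (eq , _)) with () , _ ← slot-injective i j i′ j′ 2F 1F eq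
  near-guards⇒choice i j (guardʳ _ _) (inj₁ (_ , (_ , le))) _ = contradiction le (<⇒≱ n+N<2N)
  near-guards⇒choice i j (guardʳ i′ j′) (inj₂ (eq , _)) _ with () , _ ← slot-injective i j i′ j′ 1F 2F eq
  near-guards⇒choice i j (tieˡ _ _ _ w) _ (inj₁ (_ , (le , _))) =
    contradiction le (<⇒≱ (<-trans (+-monoˡ-< N (label< w)) n+N<2N))
  near-guards⇒choice i j (tieˡ i′ j′ l′ _) _ (inj₂ (eq , _)) with () , _ ← slot-injective i j l′ i′ 2F 0F eq
  near-guards⇒choice i j (tieʳ _ _ _ w) (inj₁ (_ , (_ , le))) _ =
    contradiction le (<⇒≱ (<-≤-trans n+N<2N (≤-trans (m≤m+n (2 * N) 1) (m≤m+n (2 * N + 1) (label w)))))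
  near-guards⇒choice i j (tieʳ i′ j′ l′ _) (inj₂ (eq , _)) _ with () , _ ← slot-injective i j l′ i′ 1F 0F eq

  near-tieˡ : ∀ i j l w i′ j′ {u v p} → Near N (position (tieˡ i j l w)) (position (choice i′ j′ u v p)) →
              ((i , j) ≡ (i′ , j′) × label u ≤ label w) ⊎ ((l , i) ≡ (i′ , j′) × label w < label v)
  near-tieˡ i j l w i′ j′ (inj₁ (eq , o)) with refl , refl ← cell-injective i j i′ j′ eq = inj₁ (refl , overlap-low⁻ o)
  near-tieˡ i j l w i′ j′ (inj₂ (eq , o)) with _ , refl , refl ← slot-injective l i i′ j′ 0F 0F eq = inj₂ (refl , overlap-high⁻ o)

  near-tieʳ : ∀ i j l w i′ j′ {u v p} → Near N (position (tieʳ i j l w)) (position (choice i′ j′ u v p)) →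
              ((i , j) ≡ (i′ , j′) × label w < label u) ⊎ ((l , i) ≡ (i′ , j′) × label v ≤ label w)
  near-tieʳ i j l w i′ j′ (inj₁ (eq , o)) with refl , refl ← cell-injective i j i′ j′ eq = inj₁ (refl , overlap-high⁻ o)
  near-tieʳ i j l w i′ j′ (inj₂ (eq , o)) with _ , refl , refl ← slot-injective l i i′ j′ 0F 0F eq = inj₂ (refl , overlap-low⁻ o)

  module _ (row column : Fin K → Fin K → Fin n)
           (admissible : ∀ i j → T (entry (row i j) (column i j)) ⊎ (i ≡ j × row i j ≡ column i j))
           (dominated : ∀ m → ∃[ i ] ∃[ j ] Near N (position m) (position (choice i j (row i j) (column i j) (admissible i j))))
    where

    -- The tie whose threshold is `column l i` itself: its track 2 alternative would say that this
    -- label is less than itself, so only the track 1 alternative remains.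
    row≤column : ∀ i j l → label (row i j) ≤ label (column l i)
    row≤column i j l with i′ , j′ , near ← dominated (tieˡ i j l (column l i))
      with near-tieˡ i j l (column l i) i′ j′ {p = admissible i′ j′} near
    ... | inj₁ (refl , le) = le
    ... | inj₂ (refl , lt) = contradiction lt (<-irrefl refl)

    column≤row : ∀ i j l → label (column l i) ≤ label (row i j)
    column≤row i j l with i′ , j′ , near ← dominated (tieʳ i j l (row i j))
      with near-tieʳ i j l (row i j) i′ j′ {p = admissible i′ j′} near
    ... | inj₁ (refl , lt) = contradiction lt (<-irrefl refl)
    ... | inj₂ (refl , le) = le

    row≡column : ∀ i j l → row i j ≡ column l i
    row≡column i j l = label-injective (≤-antisym (row≤column i j l) (column≤row i j l))

    w : Fin K → Fin n
    w i = row i i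

    w-adjacent : ∀ {i j} → i ≢ j → T (entry (w i) (w j))
    w-adjacent {i} {j} i≢j with admissible i j
    ... | inj₂ (i≡j , _) = contradiction i≡j i≢j
    -- As j and l are arbitrary in `row≡column`, rows and columns are constant; both ends of the
    -- edge are carried to the diagonal, to `row i i` and `row j j`.
    ... | inj₁ e = subst₂ (λ u v → T (entry u v))
      (trans (row≡column i j i) (sym (row≡column i i i))) (sym (row≡column j j i)) e

    -- Equal vertices for different indices would be adjacent, that is, form a loop.
    w-injective : Injective _≡_ _≡_ w
    w-injective {i} {j} eq with i Fin.≟ j
    ... | yes i≡j = i≡j
    ... | no i≢j  = contradiction (subst (λ v → T (entry (w i) v)) (sym eq) (w-adjacent i≢j)) (Graph.Adj-irrefl (graph M))

    clique : IsClique (graph M) (image w)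
    clique x∈ y∈ x≢y with i , refl ← ∈-image⁻ w x∈ | j , refl ← ∈-image⁻ w y∈ =
      w-adjacent (λ i≡j → x≢y (cong w i≡j))

    consistentChoices⇒clique : HasClique (graph M) K
    consistentChoices⇒clique = image w , clique , ∣image∣≡ w w-injective

  -- The graph enters only through these data. `occurs` asks for equal positions, not equal members,
  -- because an interval of the family reveals no more than its position.
  module _ {L : ℕ} (G : Graph L) (kind : Fin L → Member)
           (occurs : ∀ m → ∃[ x ] position (kind x) ≡ position m)
           (adjacent⇔near : ∀ x y → Graph.Adj G x y ⇔ (x ≢ y × Near N (position (kind x)) (position (kind y))))
    where

    clique⇒independentDominatingSet : HasClique (graph M) K → HasIndependentDominatingSet G (K * K)
    clique⇒independentDominatingSet (C , clique , refl) =
      image pick , dominating , independent , ∣image∣≡ pick pick-injective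
      where
      e : Fin K → Fin n
      e = enumerateSubset C

      admissible : ∀ i j → T (entry (e i) (e j)) ⊎ (i ≡ j × e i ≡ e j)
      admissible i j with i Fin.≟ j
      ... | yes refl = inj₂ (refl , refl)
      ... | no i≢j   = inj₁ (clique (enumerateSubset-∈ C i) (enumerateSubset-∈ C j)
                                    (i≢j ∘ enumerateSubset-injective C))

      chosen : Fin K → Fin K → Member
      chosen i j = choice i j (e i) (e j) (admissible i j)

      pick : Fin (K * K) → Fin L
      pick c = let i , j = remQuot K c in proj₁ (occurs (chosen i j))

      position-pick : ∀ c → let i , j = remQuot K c in position (kind (pick c)) ≡ position (chosen i j)
      position-pick c = let i , j = remQuot K c in proj₂ (occurs (chosen i j))

      -- Two choices that are near share a region on some track, and this region determines the
      -- cell. Both injectivity of `pick` and independence of its image follow.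
      near⇒≡ : ∀ {c d} → Near N (position (kind (pick c))) (position (kind (pick d))) → c ≡ d
      near⇒≡ {c} {d} near = remQuot-injective K (indices (subst₂ (Near N) (position-pick c) (position-pick d) near))
        where
        i j i′ j′ : Fin K
        i = proj₁ (remQuot K c)
        j = proj₂ (remQuot {K} K c)
        i′ = proj₁ (remQuot K d)
        j′ = proj₂ (remQuot {K} K d)
        indices : Near N (position (chosen i j)) (position (chosen i′ j′)) → (i , j) ≡ (i′ , j′)
        indices (inj₁ (eq , _)) = let i≡ , j≡ = cell-injective i j i′ j′ eq in cong₂ _,_ i≡ j≡
        indices (inj₂ (eq , _)) = let _ , i≡ , j≡ = slot-injective i j i′ j′ 0F 0F eq in cong₂ _,_ i≡ j≡

      near-chosen : ∀ i j → Near N (position (chosen i j)) (position (chosen i j))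
      near-chosen i j = inj₁ (refl , overlap-choices (label≤N (e i)) (label≤N (e i)))

      pick-injective : Injective _≡_ _≡_ pick
      pick-injective {c} {d} eq = near⇒≡ {c} {d}
        (subst (λ x → Near N (position (kind (pick c))) (position (kind x))) eq
          (subst₂ (Near N) (sym (position-pick c)) (sym (position-pick c)) (near-chosen _ _)))

      near-some-chosen : ∀ m → ∃[ i ] ∃[ j ] Near N (position m) (position (chosen i j))
      near-some-chosen (choice i j u v _) = i , j , inj₁ (refl , overlap-choices (label≤N u) (label≤N (e i)))
      near-some-chosen (guardˡ i j) = i , j , inj₁ (refl , overlap-guardˡ (label< (e i)))
      near-some-chosen (guardʳ i j) = i , j , inj₁ (refl , overlap-guardʳ (label≤N (e i)))
      -- Row i and column i both show `e i`, so either outcome of the comparison lets one end of the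
      -- tie meet a choice.
      near-some-chosen (tieˡ i j l w) with label (e i) ≤? label w
      ... | yes le = i , j , inj₁ (refl , overlap-low⁺ le (label≤N w))
      ... | no ≰   = l , i , inj₂ (refl , overlap-high⁺ (≰⇒> ≰) (label≤N (e i)))
      near-some-chosen (tieʳ i j l w) with label (e i) ≤? label w
      ... | yes le = l , i , inj₂ (refl , overlap-low⁺ le (label≤N w))
      ... | no ≰   = i , j , inj₁ (refl , overlap-high⁺ (≰⇒> ≰) (label≤N (e i)))

      dominating : IsDominating G (image pick)
      dominating x with i , j , near ← near-some-chosen (kind x)
        with x Fin.≟ pick (combine i j)
      ... | yes refl = inj₁ (∈-image⁺ pick (combine i j))
      ... | no x≢    = inj₂ (pick c , ∈-image⁺ pick c , Equivalence.from (adjacent⇔near x (pick c))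
                              (x≢ , subst (Near N (position (kind x))) (sym position-c) near))
        where
        c : Fin (K * K)
        c = combine i j
        position-c : position (kind (pick c)) ≡ position (chosen i j)
        position-c = trans (position-pick c) (cong (λ (i , j) → position (chosen i j)) (Finₚ.remQuot-combine i j))

      independent : IsIndependent G (image pick)
      independent x∈ y∈ adj
        with c , refl ← ∈-image⁻ pick x∈ | d , refl ← ∈-image⁻ pick y∈
        with x≢y , near ← Equivalence.to (adjacent⇔near (pick c) (pick d)) adj
        = x≢y (cong pick (near⇒≡ {c} {d} near))

    independentDominatingSet⇒clique : HasIndependentDominatingSet G (K * K) → HasClique (graph M) K
    independentDominatingSet⇒clique (D , dominating , _ , ∣D∣≡K²) =
      consistentChoices⇒clique row column admissible dominatedByChoice
      where
      near-self : ∀ x m → position (kind x) ≡ position m → Near N (position m) (position (kind x))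
      near-self x m eq = subst (λ p → Near N p (position (kind x))) eq (reflexive (position (kind x)))
        where
        reflexive : ∀ p → Near N p p
        reflexive _ = inj₁ (refl , m≤m+n _ N , m≤m+n _ N)

      dominator : ∀ m → ∃[ y ] y ∈ D × Near N (position m) (position (kind y))
      dominator m with x , eq ← occurs m with dominating x
      ... | inj₁ x∈D             = x , x∈D , near-self x m eq
      ... | inj₂ (y , y∈D , adj) =
        y , y∈D , subst (λ p → Near N p (position (kind y))) eq (proj₂ (Equivalence.to (adjacent⇔near x y) adj))

      selected : Fin K → Fin K → Fin L
      selected i j = proj₁ (dominator (guardˡ i j))

      region-selected : ∀ i j → region (kind (selected i j)) ≡ (i , j)
      region-selected i j = near-guardˡ⇒region i j (kind (selected i j)) (proj₂ (proj₂ (dominator (guardˡ i j))))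

      selected′ : Fin (K * K) → Fin L
      selected′ c = let i , j = remQuot K c in selected i j

      selected′-injective : Injective _≡_ _≡_ selected′
      selected′-injective eq = remQuot-injective K
        (trans (sym (region-selected _ _)) (trans (cong (region ∘ kind) eq) (region-selected _ _)))

      -- The dominators of the left guards lie in K² different cells, and `D` has no more than K²
      -- elements.
      ∈D⇒selected : ∀ {y} → y ∈ D → let i , j = region (kind y) in y ≡ selected i j
      ∈D⇒selected y∈D
        with c , refl ← injective⇒onto selected′ selected′-injective
                          (λ c → let i , j = remQuot K c in proj₁ (proj₂ (dominator (guardˡ i j)))) ∣D∣≡K² y∈D
        = let i , j = remQuot K c in cong (λ (i , j) → selected i j) (sym (region-selected i j))

      -- The dominator of the right guard lies in the same cell, hence is the selected vertex; so
      -- one vertex is near both guards.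
      selected-isChoice : ∀ i j → IsChoice i j (kind (selected i j))
      selected-isChoice i j
        with y , y∈D , near ← dominator (guardʳ i j)
        with refl ← trans (∈D⇒selected y∈D)
                      (cong (λ (i , j) → selected i j) (near-guardʳ⇒region i j (kind y) near))
        = near-guards⇒choice i j (kind (selected i j)) (proj₂ (proj₂ (dominator (guardˡ i j)))) near

      dominatedBySelected : ∀ m → ∃[ i ] ∃[ j ] Near N (position m) (position (kind (selected i j)))
      dominatedBySelected m with y , y∈D , near ← dominator m =
        _ , _ , subst (λ z → Near N (position m) (position (kind z))) (∈D⇒selected y∈D) near

      row column : Fin K → Fin K → Fin n
      row i j with kind (selected i j) | selected-isChoice i j
      ... | _ | isChoice u _ _ = u
      column i j with kind (selected i j) | selected-isChoice i j
      ... | _ | isChoice _ v _ = v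

      admissible : ∀ i j → T (entry (row i j) (column i j)) ⊎ (i ≡ j × row i j ≡ column i j)
      admissible i j with kind (selected i j) | selected-isChoice i j
      ... | _ | isChoice _ _ p = p

      position-selected : ∀ i j → kind (selected i j) ≡ choice i j (row i j) (column i j) (admissible i j)
      position-selected i j with kind (selected i j) | selected-isChoice i j
      ... | _ | isChoice _ _ _ = refl

      dominatedByChoice : ∀ m → ∃[ i ] ∃[ j ] Near N (position m) (position (choice i j (row i j) (column i j) (admissible i j)))
      dominatedByChoice m with i , j , near ← dominatedBySelected m =
        i , j , subst (λ m′ → Near N (position m) (position m′)) (position-selected i j) near

-- Contents of the computed label lists

matrixRow : ∀ {n} → AdjacencyMatrix n → Fin n → List ⟦ unit ⊕ unit ⟧
matrixRow M u = tabulate λ v → encodeBool (AdjacencyMatrix.entry M u v)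

∈-cellLabels⁺ : ∀ {A : Set} {K} {xs : List A} → K ≤ length xs → ∀ (i : Fin K) → toℕ i ∈ˡ cellLabels K xs
∈-cellLabels⁺ {K = K} {xs} K≤ i with _ , _ , o , len ← Occurs-length {ys = xs} (≤-trans (Finₚ.toℕ<n i) K≤) =
  subst (_∈ˡ cellLabels K xs) len (∈-forEach⁺ (∈-enumerate⁺ o) (kept (subst (_< K) (sym len) (Finₚ.toℕ<n i))))
  where
  kept : ∀ {a} → a < K → a ∈ˡ [ (λ _ → []) , (λ _ → a ∷ []) ]′ (apply unsuc (K ∸ a))
  kept {a} a<K with K ∸ a | m<n⇒0<n∸m a<K
  ... | suc _ | _ = here refl

∈-cellLabels⁻ : ∀ {A : Set} {K} {xs : List A} {a} → a ∈ˡ cellLabels K xs → ∃[ i ] a ≡ toℕ {K} i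
∈-cellLabels⁻ {K = K} {xs} {a} a∈ with (b , _) , _ , b∈ ← ∈-forEach⁻ {xs = enumerate xs} a∈ =
  kept {b} b∈
  where
  kept : ∀ {b} → a ∈ˡ [ (λ _ → []) , (λ _ → b ∷ []) ]′ (apply unsuc (K ∸ b)) → ∃[ i ] a ≡ toℕ {K} i
  kept {b} a∈ with K ∸ b in eq | a∈
  ... | suc _ | here refl = Fin.fromℕ< (m∸n≢0⇒n<m λ eq′ → contradiction (trans (sym eq) eq′) λ ()) , sym (Finₚ.toℕ-fromℕ< _)

∈-vertexLabels⁺ : ∀ {A : Set} {n} (f : Fin n → A) u → label u ∈ˡ vertexLabels (tabulate f)
∈-vertexLabels⁺ f u = ∈-forEach⁺ (∈-enumerate-tabulate⁺ f u) (here refl)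

∈-vertexLabels⁻ : ∀ {A : Set} {n} (f : Fin n → A) {a} → a ∈ˡ vertexLabels (tabulate f) → ∃[ u ] a ≡ label u
∈-vertexLabels⁻ f a∈ with _ , p∈ , here refl ← ∈-forEach⁻ {g = λ (a , _) → a ∷ []} {xs = enumerate (tabulate f)} a∈
  with u , refl ← ∈-enumerate-tabulate⁻ f p∈ = u , refl

module _ {n : ℕ} (M : AdjacencyMatrix n) where

  open AdjacencyMatrix M

  ∈-edgeLabels⁺ : ∀ u v → T (entry u v) → (label u , label v) ∈ˡ edgeLabels (encodeMatrix M)
  ∈-edgeLabels⁺ u v e =
    ∈-forEach⁺ (∈-enumerate-tabulate⁺ (matrixRow M) u)
      (∈-forEach⁺ (∈-enumerate-tabulate⁺ (λ v → encodeBool (entry u v)) v) (kept (entry u v) e))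
    where
    kept : ∀ b → T b → (label u , label v) ∈ˡ [ (λ _ → []) , (λ _ → (label u , label v) ∷ []) ]′ (encodeBool b)
    kept true _ = here refl

  ∈-edgeLabels⁻ : ∀ {p} → p ∈ˡ edgeLabels (encodeMatrix M) →
                  ∃[ u ] ∃[ v ] T (entry u v) × p ≡ (label u , label v)
  ∈-edgeLabels⁻ {p} p∈
    with _ , r∈ , p∈row ← ∈-forEach⁻ {xs = enumerate (encodeMatrix M)} p∈
    with u , refl ← ∈-enumerate-tabulate⁻ (matrixRow M) r∈
    with _ , e∈ , p∈entry ← ∈-forEach⁻ {xs = enumerate (matrixRow M u)} p∈row
    with v , refl ← ∈-enumerate-tabulate⁻ (λ v → encodeBool (entry u v)) e∈ = u , v , kept (entry u v) p∈entry
    where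
    kept : ∀ {q} b → p ∈ˡ [ (λ _ → []) , (λ _ → q ∷ []) ]′ (encodeBool b) → T b × p ≡ q
    kept true (here eq) = _ , eq

-- Equal coordinates overlap in particular, so the regions agree and the offsets follow by
-- cancellation.
coordinate-injective : ∀ {N} → 1 ≤ N → ∀ {p q} → proj₂ p ≤ 3 * N → proj₂ q ≤ 3 * N →
                       coordinate N p ≡ coordinate N q → p ≡ q
coordinate-injective {N} 1≤N {r , o} {r′ , o′} o≤ o′≤ eq
  with refl , _ ← overlap-coordinate⁻ 1≤N {r} {o} {r′} {o′} o≤ o′≤
                    (≤-trans (≤-reflexive eq) (m≤m+n _ N) , ≤-trans (≤-reflexive (sym eq)) (m≤m+n _ N))
  = cong (r ,_) (+-cancelˡ-≡ (5 * N * r) o o′ eq)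

place-injective : ∀ {n p q} → OffsetsBounded (suc n) p → OffsetsBounded (suc n) q → place n p ≡ place n q → p ≡ q
place-injective {n} (a≤ , b≤) (a′≤ , b′≤) eq = cong₂ _,_
  (coordinate-injective (s≤s z≤n) a≤ a′≤ (ℤₚ.+-injective (cong (ℚᵘ.ℚᵘ.numerator ∘ Unit2TrackInterval.left₁) eq)))
  (coordinate-injective (s≤s z≤n) b≤ b′≤ (ℤₚ.+-injective (cong (ℚᵘ.ℚᵘ.numerator ∘ Unit2TrackInterval.left₂) eq)))

-- The computed family realises exactly the members

module Correctness {n K : ℕ} (M : AdjacencyMatrix n) (K≤ : K ≤ suc n) where

  open AdjacencyMatrix M
  open Reduction M K

  private
    cs vs : List ℕ
    cs = cellLabels K ([] ∷ encodeMatrix M)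
    vs = vertexLabels (encodeMatrix M)

    es : List (ℕ × ℕ)
    es = edgeLabels (encodeMatrix M)

    diagonalPart edgePart guardPart tiePart : List ⟦ Position ⟧
    diagonalPart = diagonalChoices N K cs vs es
    edgePart     = edgeChoices N K cs vs es
    guardPart    = guards N K cs vs es
    tiePart      = ties N K cs vs es

    inCells : ∀ (i : Fin K) → toℕ i ∈ˡ cs
    inCells = ∈-cellLabels⁺ {xs = [] ∷ encodeMatrix M} (≤-trans K≤ (≤-reflexive (cong suc (sym (length-tabulate (matrixRow M))))))

    inVertices : ∀ u → label u ∈ˡ vs
    inVertices = ∈-vertexLabels⁺ (matrixRow M)

    -- In continuation form, so that a nest of loops is inverted by the same nest of eliminators.
    elimCells : ∀ {B : Set} {g : ℕ → List B} {y} {P : Set} →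
                (∀ (i : Fin K) → y ∈ˡ g (toℕ i) → P) → y ∈ˡ forEach cs g → P
    elimCells {g = g} f y∈ with _ , i∈ , y∈g ← ∈-forEach⁻ {g = g} {xs = cs} y∈
      with i , refl ← ∈-cellLabels⁻ {K = K} {xs = [] ∷ encodeMatrix M} i∈ = f i y∈g

    elimVertices : ∀ {B : Set} {g : ℕ → List B} {y} {P : Set} →
                   (∀ (u : Fin n) → y ∈ˡ g (label u) → P) → y ∈ˡ forEach vs g → P
    elimVertices {g = g} f y∈ with _ , u∈ , y∈g ← ∈-forEach⁻ {g = g} {xs = vs} y∈
      with u , refl ← ∈-vertexLabels⁻ (matrixRow M) u∈ = f u y∈g

    elimEdges : ∀ {B : Set} {g : ℕ × ℕ → List B} {y} {P : Set} →
                (∀ u v → T (entry u v) → y ∈ˡ g (label u , label v) → P) → y ∈ˡ forEach es g → P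
    elimEdges {g = g} {y} {P} f y∈ = let _ , e∈ , y∈g = ∈-forEach⁻ y∈ in at (∈-edgeLabels⁻ M e∈) y∈g
      where
      at : ∀ {e} → ∃[ u ] ∃[ v ] T (entry u v) × e ≡ (label u , label v) → y ∈ˡ g e → P
      at (u , v , uv , refl) = f u v uv

    ∈-diagonalChoices⁻ : ∀ {p} → p ∈ˡ diagonalPart → ∃[ m ] p ≡ position m
    ∈-diagonalChoices⁻ = elimCells λ i → elimVertices λ where
      u (here eq) → choice i i u u (inj₂ (refl , refl)) , eq

    ∈-edgeChoices⁻ : ∀ {p} → p ∈ˡ edgePart → ∃[ m ] p ≡ position m
    ∈-edgeChoices⁻ = elimCells λ i → elimCells λ j → elimEdges λ where
      u v uv (here eq) → choice i j u v (inj₁ uv) , eq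

    ∈-guards⁻ : ∀ {p} → p ∈ˡ guardPart → ∃[ m ] p ≡ position m
    ∈-guards⁻ = elimCells λ i → elimCells λ where
      j (here eq)         → guardˡ i j , eq
      j (there (here eq)) → guardʳ i j , eq

    ∈-ties⁻ : ∀ {p} → p ∈ˡ tiePart → ∃[ m ] p ≡ position m
    ∈-ties⁻ = elimCells λ i → elimCells λ j → elimCells λ l → elimVertices λ where
      w (here eq)         → tieˡ i j l w , eq
      w (there (here eq)) → tieʳ i j l w , eq

  ∈-layout⁻ : ∀ {p} → p ∈ˡ layout n K (encodeMatrix M) → ∃[ m ] p ≡ position m
  ∈-layout⁻ p∈ with reverseAcc⁻ (edgePart ʳ++ guardPart ʳ++ tiePart) diagonalPart p∈
  ... | inj₂ p∈ = ∈-diagonalChoices⁻ p∈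
  ... | inj₁ p∈ with reverseAcc⁻ (guardPart ʳ++ tiePart) edgePart p∈
  ...   | inj₂ p∈ = ∈-edgeChoices⁻ p∈
  ...   | inj₁ p∈ with reverseAcc⁻ tiePart guardPart p∈
  ...     | inj₂ p∈ = ∈-guards⁻ p∈
  ...     | inj₁ p∈ = ∈-ties⁻ p∈

  private
    allParts : List ⟦ Position ⟧
    allParts = layout n K (encodeMatrix M)

    afterDiagonal : ∀ {p} → p ∈ˡ edgePart ʳ++ guardPart ʳ++ tiePart → p ∈ˡ allParts
    afterDiagonal p∈ = reverseAcc⁺ (edgePart ʳ++ guardPart ʳ++ tiePart) diagonalPart (inj₁ p∈)

    afterEdges : ∀ {p} → p ∈ˡ guardPart ʳ++ tiePart → p ∈ˡ allParts
    afterEdges p∈ = afterDiagonal (reverseAcc⁺ (guardPart ʳ++ tiePart) edgePart (inj₁ p∈))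

  position∈layout : ∀ m → position m ∈ˡ layout n K (encodeMatrix M)
  position∈layout (choice i i u u (inj₂ (refl , refl))) = reverseAcc⁺ (edgePart ʳ++ guardPart ʳ++ tiePart) diagonalPart
    (inj₂ (∈-forEach⁺ (inCells i) (∈-forEach⁺ (inVertices u) (here refl))))
  position∈layout (choice i j u v (inj₁ uv)) = afterDiagonal (reverseAcc⁺ (guardPart ʳ++ tiePart) edgePart
    (inj₂ (∈-forEach⁺ (inCells i) (∈-forEach⁺ (inCells j) (∈-forEach⁺ (∈-edgeLabels⁺ M u v uv) (here refl))))))
  position∈layout (guardˡ i j) = afterEdges (reverseAcc⁺ tiePart guardPart
    (inj₂ (∈-forEach⁺ (inCells i) (∈-forEach⁺ (inCells j) (here refl)))))
  position∈layout (guardʳ i j) = afterEdges (reverseAcc⁺ tiePart guardPart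
    (inj₂ (∈-forEach⁺ (inCells i) (∈-forEach⁺ (inCells j) (there (here refl))))))
  position∈layout (tieˡ i j l w) = afterEdges (reverseAcc⁺ tiePart guardPart
    (inj₁ (∈-forEach⁺ (inCells i) (∈-forEach⁺ (inCells j) (∈-forEach⁺ (inCells l)
      (∈-forEach⁺ (inVertices w) (here refl)))))))
  position∈layout (tieʳ i j l w) = afterEdges (reverseAcc⁺ tiePart guardPart
    (inj₁ (∈-forEach⁺ (inCells i) (∈-forEach⁺ (inCells j) (∈-forEach⁺ (inCells l)
      (∈-forEach⁺ (inVertices w) (there (here refl))))))))

  F : List Unit2TrackInterval
  F = family n K (encodeMatrix M)

  opaque
    memberAt : ∀ x → ∃[ m ] lookup F x ≡ place n (position m)
    memberAt x with p , p∈ , here eq ← ∈-forEach⁻ {xs = layout n K (encodeMatrix M)} (∈-lookup {xs = F} x)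
      with m , refl ← ∈-layout⁻ p∈ = m , eq

  kind : Fin (length F) → Member
  kind = proj₁ ∘ memberAt

  occurs : ∀ m → ∃[ x ] position (kind x) ≡ position m
  occurs m = index m∈F , place-injective (offsetsBounded (kind (index m∈F))) (offsetsBounded m)
    (trans (sym (proj₂ (memberAt (index m∈F)))) (sym (lookup-index m∈F)))
    where
    m∈F : place n (position m) ∈ˡ F
    m∈F = ∈-forEach⁺ (position∈layout m) (here refl)

  adjacent⇔near : ∀ x y → Graph.Adj (unit2TrackGraph F) x y ⇔ (x ≢ y × Near N (position (kind x)) (position (kind y)))
  adjacent⇔near x y = mk⇔
    (λ (x≢y , meet) → x≢y , meet⇒near n (position (kind x)) (position (kind y)) (offsetsBounded (kind x)) (offsetsBounded (kind y))
                              (subst₂ (λ I J → points I ≬ points J) (proj₂ (memberAt x)) (proj₂ (memberAt y)) meet))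
    (λ (x≢y , near) → x≢y , subst₂ (λ I J → points I ≬ points J) (sym (proj₂ (memberAt x))) (sym (proj₂ (memberAt y)))
                              (near⇒meet n (position (kind x)) (position (kind y)) near))
    where open Unit2TrackInterval using (points)

  clique⇔independentDominatingSet : HasClique (graph M) K ⇔ HasIndependentDominatingSet (unit2TrackGraph F) (K * K)
  clique⇔independentDominatingSet = mk⇔
    (clique⇒independentDominatingSet (unit2TrackGraph F) kind occurs adjacent⇔near)
    (independentDominatingSet⇒clique (unit2TrackGraph F) kind occurs adjacent⇔near)

-- Capping the clique size and assembling the reduction

cliqueSize≤ : ∀ n k → cliqueSize n k ≤ suc n
cliqueSize≤ n k with ≤-total k (suc n)
... | inj₁ k≤ = ≤-trans (m∸n≤m k (k ∸ suc n)) k≤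
... | inj₂ ≤k = ≤-reflexive (m∸[m∸n]≡n ≤k)

-- Below the cap the size is unchanged; from n + 1 on, neither size is attained by a set of
-- vertices, so both sides are false.
cliqueSize-correct : ∀ {n} (G : Graph n) k → HasClique G k ⇔ HasClique G (cliqueSize n k)
cliqueSize-correct {n} G k with ≤-total k (suc n)
... | inj₁ k≤ rewrite m≤n⇒m∸n≡0 k≤ = mk⇔ (λ c → c) (λ c → c)
... | inj₂ ≤k rewrite m∸[m∸n]≡n ≤k = mk⇔
  (λ (C , _ , ∣C∣≡k) → contradiction (≤-trans ≤k (≤-trans (≤-reflexive (sym ∣C∣≡k)) (∣p∣≤n C))) (<-irrefl refl))
  (λ (C , _ , ∣C∣≡)  → contradiction (≤-trans (≤-reflexive (sym ∣C∣≡)) (∣p∣≤n C)) (<-irrefl refl))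

module _ where
  private
    module P = ParamProblem k-Clique
    module Q = ParamProblem k-IndependentDominatingSet-Unit2Track

  reduce : P.Instance → Q.Instance
  reduce ((n , M) , k) = let K = cliqueSize n k in family n K (encodeMatrix M) , K * K

  reduction-computes : ∀ x → fun reduction (P.encode x) ≡ Q.encode (reduce x)
  reduction-computes ((n , M) , k) = reduction-fun (encodeMatrix M) k (length-tabulate (matrixRow M))

  -- The combinators bound the time by a power of s + 1, the reduction requires a power of s. Since
  -- s is at least 2, s + 1 ≤ s², which doubles the exponent.
  reduction-time : ∀ x → ∃[ t ] Run (prog reduction) (P.encode x) (Q.encode (reduce x)) t
                                × t ≤ 1 * P.∥ x ∥ ^ (2 * deg reduction)
  reduction-time x with t , r , poly t≤ ← runs reduction (P.encode x) =
    t , subst (λ y → Run (prog reduction) (P.encode x) y t) (reduction-computes x) r , (begin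
      t                             ≤⟨ t≤ ⟩
      suc s ^ deg reduction         ≤⟨ ^-monoˡ-≤ (deg reduction) suc-s≤s² ⟩
      (s ^ 2) ^ deg reduction       ≡⟨ ^-*-assoc s 2 (deg reduction) ⟩
      s ^ (2 * deg reduction)       ≡⟨ *-identityˡ _ ⟨
      1 * s ^ (2 * deg reduction)   ∎)
    where
    open ≤-Reasoning
    s : ℕ
    s = P.∥ x ∥
    2≤s : 2 ≤ s
    2≤s = s≤s (≤-trans (1≤size nat (P.param x)) (m≤n+m _ (size (list (list (unit ⊕ unit))) (proj₁ (P.encode x)))))
    suc-s≤s² : suc s ≤ s ^ 2
    suc-s≤s² = begin
      1 + s         ≤⟨ +-monoˡ-≤ s (≤-trans (s≤s z≤n) 2≤s) ⟩
      s + s         ≡⟨ cong (s +_) (+-identityʳ s) ⟨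
      2 * s         ≤⟨ *-monoˡ-≤ s 2≤s ⟩
      s * s         ≡⟨ cong (s *_) (*-identityʳ s) ⟨
      s ^ 2         ∎

theorem4 : W[1]-Hard k-IndependentDominatingSet-Unit2Track
theorem4 = record
  { f            = reduce
  ; equivalent   = λ ((n , M) , k) →
      Correctness.clique⇔independentDominatingSet M (cliqueSize≤ n k) ⇔-∘ cliqueSize-correct (graph M) k
  ; program      = prog reduction
  -- The reduction runs in polynomial time, so no factor depending on k is called for.
  ; g            = λ _ → 1
  ; h            = λ k → k * k
  ; g-computable = prim (lit 1) , λ n → _ , run-prim (lit 1) n
  ; h-computable = ⟨ prim id , prim id ⟩ ⨾ prim mul ,
      λ n → _ , run-⨾ (run-⟨,⟩ (run-prim id n) (run-prim id n)) (run-prim mul (n , n))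
  ; exponent     = 2 * deg reduction
  ; runs         = reduction-time
  ; param-bound  = λ ((n , M) , k) → *-mono-≤ (m∸n≤m k (k ∸ suc n)) (m∸n≤m k (k ∸ suc n))
  }
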